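{- For every $SP$-poset $P$ define the series $$\mathcal{SH}(P)=\sum_{i=1}^{|P|}(-1)^{|P|-i}d_{P,i}\frac{1}{(1-x)^{i+1}},\quad dd\mathcal{SH}(P)=\sum_{i=1}^{|P|}(-1)^{|P|-i}d_{P,i}(1-x)^{i-1},\quad ldd\mathcal{SH}(P)=\sum_{i=1}^{|P|}d_{P,i}\frac{x^{i+1}}{(1-x)^{i+1}},$$ called respectively the colimit-indexing, right deck-divider and left deck-divider shuffle series. These three families have the following structure of algebras over the operad $\mathcal{SP}$ (in each case the operation $\sqcup$, respectively $\oplus$, applied to the series of $P$ and $Q$ gives the series of $P\sqcup Q$, respectively $P\oplus Q$): (1) $\{\mathcal{SH}(P)\}$: generator $\mathcal{SH}(1)=\frac{1}{(1-x)^2}$, unit $\mathcal{SH}(\varnothing)=\frac{1}{1-x}$, $\sqcup$ acts by the Hadamard product, and $\oplus$ acts by $(f,g)\mapsto f(1-x)g$. (2) $\{dd\mathcal{SH}(P)\}$: generator $dd\mathcal{SH}(1)=1$, unit $dd\mathcal{SH}(\varnothing)=\frac{1}{1-x}$, $\sqcup$ acts by $(f,g)\mapsto \psi(\psi^{ -1}(f)\odot\psi^{ -1}(g))$, where $\odot$ is the Hadamard product and $\psi$ is the linear change of basis $\frac{1}{(1-x)^{k+1}}\mapsto(1-x)^{k-1}$ ($k\ge 0$), and $\oplus$ acts by $(f,g)\mapsto f(1-x)g$. (3) $\{ldd\mathcal{SH}(P)\}$: generator $ldd\mathcal{SH}(1)=\frac{x^2}{(1-x)^2}$, unit $\frac{x}{1-x}$,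 $\sqcup$ acts by the Hadamard product, and $\oplus$ acts by $(f,g)\mapsto f\frac{1-x}{x}g$.
   Context: Posets are finite. $P\sqcup Q$ is the disjoint union; $P\oplus Q$ is the ordinal sum (every element of $P$ below every element of $Q$). An $SP$-poset is a poset obtained from one-point posets by finitely many applications of $\sqcup$ and $\oplus$. The operad $\mathcal{SP}$ is the operad generated by the binary operations $\sqcup$ and $\oplus$; for a series $F$, $F(1)$ denotes the series of the one-point poset. "Generator" is the series of the one-point poset; "unit" is an identity element for both binary operations. The integers $d_{P,i}$ are defined by $\Omega^\circ(P,x)=\sum_{i=1}^{|P|}d_{P,i}\binom{x}{i}$, where $\Omega^\circ(P,n)$ is the number of strict order-preserving maps from $P$ to the chain $1<\cdots<n$. The Hadamard product is the coefficientwise product of power series. -}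

module Defs where

open import Algebra.Core using (Op₂)
open import Algebra.Definitions using (Congruent₂; Identity)
open import Data.Fin.Base using (Fin; zero; suc; toℕ; finToFun; splitAt)
open import Data.Fin.Properties using (_≟_; all?)
import Data.Fin.Base as Fin
import Data.Fin.Properties as Fin
open import Data.Integer.Base using (ℤ; +_; _+_; _*_; _-_; 0ℤ; 1ℤ; -1ℤ)
import Data.Integer.Base as ℤ
import Data.Integer.Properties as ℤ
open import Data.Integer.Tactic.RingSolver using (solve-∀)
open import Data.List.Base using (List; []; _∷_; length; filter; allFin)
import Data.List.Base as List
open import Data.Nat.Base using (ℕ; zero; suc; _∸_)
import Data.Nat.Base as ℕ
open import Data.Nat.Combinatorics using (_C_)
open import Data.Product.Base using (Σ-syntax; _×_; _,_; proj₁; proj₂)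
open import Data.Sum.Base using (_⊎_; inj₁; inj₂; [_,_]′)
open import Data.Sum.Relation.Binary.LeftOrder using (_⊎-<_; ⊎-<-isPartialOrder; ⊎-<-decidable)
open import Data.Sum.Relation.Binary.Pointwise using (Pointwise; ⊎-isPartialOrder; ⊎-decidable; Pointwise-≡⇒≡; ≡⇒Pointwise-≡)
open import Data.Unit.Base using (⊤)
open import Function.Base using (_∘_; _on_)
open import Function.Definitions using (Bijective)
open import Level using (0ℓ)
import Level
open import Relation.Binary.Bundles using (Setoid)
open import Relation.Binary.Core using (Rel)
open import Relation.Binary.Definitions using (Decidable)
open import Relation.Binary.Morphism.Structures using (IsOrderIsomorphism)
open import Relation.Binary.PropositionalEquality
open import Relation.Binary.Structures using (IsPartialOrder; IsDecPartialOrder)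
import Relation.Binary.Construct.NonStrictToStrict as Strict
open import Relation.Nullary.Decidable using (Dec; _→-dec_)

open import Algebra.Properties.Semiring.Sum ℤ.+-*-semiring public using (sum; sum-syntax)

record FinPoset : Set₁ where
  infix 4 _≤_
  field
    size              : ℕ
    _≤_               : Rel (Fin size) 0ℓ
    isDecPartialOrder : IsDecPartialOrder _≡_ _≤_

  open IsDecPartialOrder isDecPartialOrder public
    using (isPartialOrder; _≤?_)

  open Strict _≡_ _≤_ public using (_<_)

  _<?_ : Decidable _<_
  _<?_ = Strict.<-decidable _≡_ _≤_ _≟_ _≤?_

open FinPoset using (size)

infix 4 _≅_

_≅_ : FinPoset → FinPoset → Set
P ≅ Q = Σ[ φ ∈ (Fin (size P) → Fin (size Q)) ]
  IsOrderIsomorphism _≡_ _≡_ (FinPoset._≤_ P) (FinPoset._≤_ Q) φ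

∅ : FinPoset
∅ = record
  { size = 0 ; _≤_ = _≡_
  ; isDecPartialOrder = record
    { isPartialOrder = isPartialOrder ; _≟_ = _≟_ ; _≤?_ = _≟_ } }

pt : FinPoset
pt = record
  { size = 1 ; _≤_ = _≡_
  ; isDecPartialOrder = record
    { isPartialOrder = isPartialOrder ; _≟_ = _≟_ ; _≤?_ = _≟_ } }

-- Fin (m + n) carries an order on Fin m ⊎ Fin n along the bijection splitAt m.

transport : ∀ m n {_∼_ : Rel (Fin m ⊎ Fin n) 0ℓ} →
            IsPartialOrder (Pointwise _≡_ _≡_) _∼_ → Decidable _∼_ →
            IsDecPartialOrder {A = Fin (m ℕ.+ n)} _≡_ (_∼_ on splitAt m)
transport m n po dec = record
  { isPartialOrder = record
    { isPreorder = record
      { isEquivalence = isEquivalence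
      ; reflexive     = λ { refl → PO.reflexive (≡⇒Pointwise-≡ refl) }
      ; trans         = PO.trans }
    ; antisym = λ p q → splitAt-injective (Pointwise-≡⇒≡ (PO.antisym p q)) }
  ; _≟_  = _≟_
  ; _≤?_ = λ i j → dec (splitAt m i) (splitAt m j) }
  where
  module PO = IsPartialOrder po
  splitAt-injective : ∀ {i j} → splitAt m {n} i ≡ splitAt m j → i ≡ j
  splitAt-injective {i} {j} eq = trans (sym (Fin.join-splitAt m n i))
    (trans (cong (Fin.join m n) eq) (Fin.join-splitAt m n j))

infixr 6 _⊔_ _⊕_

_⊔_ : FinPoset → FinPoset → FinPoset
P ⊔ Q = record
  { size = P.size ℕ.+ Q.size
  ; _≤_  = Pointwise P._≤_ Q._≤_ on splitAt P.size
  ; isDecPartialOrder = transport P.size Q.size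
      (⊎-isPartialOrder P.isPartialOrder Q.isPartialOrder)
      (⊎-decidable P._≤?_ Q._≤?_) }
  where module P = FinPoset P ; module Q = FinPoset Q

_⊕_ : FinPoset → FinPoset → FinPoset
P ⊕ Q = record
  { size = P.size ℕ.+ Q.size
  ; _≤_  = (P._≤_ ⊎-< Q._≤_) on splitAt P.size
  ; isDecPartialOrder = transport P.size Q.size
      (⊎-<-isPartialOrder P.isPartialOrder Q.isPartialOrder)
      (⊎-<-decidable P._≤?_ Q._≤?_) }
  where module P = FinPoset P ; module Q = FinPoset Q

data Expr (X : Set) : Set where
  leaf      : X → Expr X
  _⊔ᵉ_ _⊕ᵉ_ : Expr X → Expr X → Expr X

⟦_⟧ : ∀ {X} → Expr X → FinPoset
⟦ leaf x ⟧ = pt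
⟦ s ⊔ᵉ t ⟧ = ⟦ s ⟧ ⊔ ⟦ t ⟧
⟦ s ⊕ᵉ t ⟧ = ⟦ s ⟧ ⊕ ⟦ t ⟧

label : ∀ {X} (t : Expr X) → Fin (size ⟦ t ⟧) → X
label (leaf x) _ = x
label (s ⊔ᵉ t) i = [ label s , label t ]′ (splitAt (size ⟦ s ⟧) i)
label (s ⊕ᵉ t) i = [ label s , label t ]′ (splitAt (size ⟦ s ⟧) i)

IsSP : FinPoset → Set
IsSP P = Σ[ t ∈ Expr ⊤ ] ⟦ t ⟧ ≅ P

-- The SP-posets together with the empty poset, which indexes the units.
IsSP∅ : FinPoset → Set
IsSP∅ P = IsSP P ⊎ (∅ ≅ P)

-- An n-ary operation of the operad is a composite of the generators ⊔ and
-- ⊕ in which each of n inputs occurs exactly once; two composites are the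
-- same operation when they define the same partial order on the n inputs.
-- An algebra is an operad morphism 𝒮𝒫 → End(A).  Since it preserves
-- composition, units and permutations of the inputs, it is evaluation
-- with respect to the images of the two generators, and evaluation must
-- identify composites that are the same operation.

record 𝒮𝒫 (n : ℕ) : Set where
  field
    expr    : Expr (Fin n)
    linear  : Bijective _≡_ _≡_ (label expr)

open 𝒮𝒫 public

infix 4 _≐_

_≐_ : ∀ {n} → 𝒮𝒫 n → 𝒮𝒫 n → Set
σ ≐ τ = Σ[ φ ∈ ⟦ expr σ ⟧ ≅ ⟦ expr τ ⟧ ] label (expr τ) ∘ proj₁ φ ≗ label (expr σ)

eval : ∀ {a} {X : Set} {A : Set a} → Op₂ A → Op₂ A → Expr X → (X → A) → A
eval _∪_ _∙_ (leaf x) a = a x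
eval _∪_ _∙_ (s ⊔ᵉ t) a = eval _∪_ _∙_ s a ∪ eval _∪_ _∙_ t a
eval _∪_ _∙_ (s ⊕ᵉ t) a = eval _∪_ _∙_ s a ∙ eval _∪_ _∙_ t a

record 𝒮𝒫-Algebra {c ℓ} (A : Setoid c ℓ) : Set (c Level.⊔ ℓ) where
  open Setoid A
  field
    act-⊔  : Op₂ Carrier
    act-⊕  : Op₂ Carrier
    cong-⊔ : Congruent₂ _≈_ act-⊔
    cong-⊕ : Congruent₂ _≈_ act-⊕

  act : ∀ {n} → 𝒮𝒫 n → (Fin n → Carrier) → Carrier
  act σ = eval act-⊔ act-⊕ (expr σ)

  field
    act-cong : ∀ {n} {σ τ : 𝒮𝒫 n} → σ ≐ τ → ∀ a → act σ a ≈ act τ a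

IsStrictMap : (P : FinPoset) (n : ℕ) → (Fin (size P) → Fin n) → Set
IsStrictMap P n f = ∀ i j → i P.< j → f i Fin.< f j
  where module P = FinPoset P

isStrictMap? : ∀ P n f → Dec (IsStrictMap P n f)
isStrictMap? P n f =
  all? λ i → all? λ j → (i P.<? j) →-dec (f i Fin.<? f j)
  where module P = FinPoset P

-- finToFun enumerates the n ^ |P| maps from P to Fin n without repetition.
Ω° : FinPoset → ℕ → ℕ
Ω° P n = length (filter (isStrictMap? P n ∘ finToFun) (allFin (n ℕ.^ size P)))

-- The sum of f i over 1 ≤ i ≤ m, except that for m = 0 (which occurs only
-- for the empty poset, where Ω°(∅,x) = 1 = binom(x,0)) it is the i = 0 term.
∑₁ : ℕ → (ℕ → ℤ) → ℤ
∑₁ zero    f = f 0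
∑₁ (suc m) f = ∑[ i < suc m ] f (suc (toℕ i))

IsStrictCoefficients : (FinPoset → ℕ → ℤ) → Set₁
IsStrictCoefficients d = ∀ P → IsSP∅ P → ∀ n →
  + Ω° P n ≡ ∑₁ (size P) λ i → d P i * + (n C i)

-- The coefficient of x^n is the value at n.
Series : Set
Series = ℕ → ℤ

𝟏 : Series
𝟏 zero    = 1ℤ
𝟏 (suc _) = 0ℤ

𝐱 : Series
𝐱 1 = 1ℤ
𝐱 _ = 0ℤ

1-x : Series
1-x n = 𝟏 n - 𝐱 n

infixl 7 _·_ _⊙_
infixr 8 _^_

_·_ : Series → Series → Series
(f · g) n = ∑[ k < suc n ] (f (toℕ k) * g (n ∸ toℕ k))

_^_ : Series → ℕ → Series
f ^ zero  = 𝟏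
f ^ suc k = f · f ^ k

_⊙_ : Series → Series → Series
(f ⊙ g) n = f n * g n

1/[1-x] : Series
1/[1-x] _ = 1ℤ

1/[1-x]-inverse : 1-x · 1/[1-x] ≗ 𝟏
1/[1-x]-inverse zero    = refl
1/[1-x]-inverse (suc n) = cong (λ z → 1ℤ + (-1ℤ + z)) (zeros n)
  where
  zeros : ∀ m → ∑[ k < m ] 0ℤ ≡ 0ℤ
  zeros zero    = refl
  zeros (suc m) = cong (λ z → 0ℤ + z) (zeros m)

-- The quotient by x of a series with zero constant term.
_/x : Series → Series
(f /x) n = f (suc n)

1/[1-x]^1+ : ℕ → Series
1/[1-x]^1+ k = 1/[1-x] ^ suc k

-- k ↦ (1 - x)^(k - 1)
[1-x]^-1+ : ℕ → Series
[1-x]^-1+ zero    = 1/[1-x]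
[1-x]^-1+ (suc k) = 1-x ^ k

module _ (d : FinPoset → ℕ → ℤ) (P : FinPoset) where

  SH : Series
  SH n = ∑₁ (size P) λ i → -1ℤ ℤ.^ (size P ∸ i) * d P i * 1/[1-x]^1+ i n

  ddSH : Series
  ddSH n = ∑₁ (size P) λ i → -1ℤ ℤ.^ (size P ∸ i) * d P i * [1-x]^-1+ i n

  lddSH : Series
  lddSH n = ∑₁ (size P) λ i → d P i * (𝐱 ^ suc i · 1/[1-x]^1+ i) n

-- The finite sum of c_k b_k, for the list c_0, c_1, … of coefficients.
combination : (ℕ → Series) → List ℤ → Series
combination b []       n = 0ℤ
combination b (c ∷ cs) n = c * b 0 n + combination (b ∘ suc) cs n

record Span (b : ℕ → Series) : Set where
  constructor span
  field
    series    : Series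
    coeffs    : List ℤ
    expansion : series ≗ combination b coeffs

open Span public

ψ : Span 1/[1-x]^1+ → Span [1-x]^-1+
ψ f = span (combination [1-x]^-1+ (coeffs f)) (coeffs f) (λ _ → refl)

ψ⁻¹ : Span [1-x]^-1+ → Span 1/[1-x]^1+
ψ⁻¹ f = span (combination 1/[1-x]^1+ (coeffs f)) (coeffs f) (λ _ → refl)

-- The span of the 1/(1-x)^(k+1) is closed under the Hadamard product.  As
-- 1/(1-x)^(k+2) is the series of partial sums of 1/(1-x)^(k+1), and partial
-- sums S satisfy S f ⊙ S g = S (f ⊙ S g + S f ⊙ g - f ⊙ g), coefficients of
-- a product are found by recursion; shifted-mul treats S f ⊙ g.

infixl 6 _⊞_

_⊞_ : List ℤ → List ℤ → List ℤ
[]       ⊞ ds       = ds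
(c ∷ cs) ⊞ []       = c ∷ cs
(c ∷ cs) ⊞ (d ∷ ds) = c + d ∷ cs ⊞ ds

scale : ℤ → List ℤ → List ℤ
scale c = List.map (c *_)

mul shifted-mul : List ℤ → List ℤ → List ℤ
mul []       ds = []
mul (c ∷ cs) ds = scale c ds ⊞ shifted-mul cs ds
shifted-mul cs []       = []
shifted-mul cs (d ∷ ds) =
  0ℤ ∷ scale d cs ⊞ (mul cs (0ℤ ∷ ds) ⊞ shifted-mul cs ds ⊞ scale -1ℤ (mul cs ds))

private
  ⊞-correct : ∀ b cs ds n →
    combination b (cs ⊞ ds) n ≡ combination b cs n + combination b ds n
  ⊞-correct b []       ds       n = sym (ℤ.+-identityˡ _)
  ⊞-correct b (c ∷ cs) []       n = sym (ℤ.+-identityʳ _)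
  ⊞-correct b (c ∷ cs) (d ∷ ds) n
    rewrite ⊞-correct (b ∘ suc) cs ds n = lem c d (b 0 n) _ _
    where
    lem : ∀ c d x y z → (c + d) * x + (y + z) ≡ (c * x + y) + (d * x + z)
    lem = solve-∀

  scale-correct : ∀ b c cs n →
    combination b (scale c cs) n ≡ c * combination b cs n
  scale-correct b c []       n = sym (ℤ.*-zeroʳ c)
  scale-correct b c (d ∷ ds) n
    rewrite scale-correct (b ∘ suc) c ds n = lem c d (b 0 n) _
    where
    lem : ∀ c d x y → c * d * x + c * y ≡ c * (d * x + y)
    lem = solve-∀

  S : Series → Series
  S f = 1/[1-x] · f

  S-cong : ∀ {f g} → f ≗ g → S f ≗ S g
  S-cong f≗g zero    = cong (λ z → 1ℤ * z + 0ℤ) (f≗g 0)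
  S-cong f≗g (suc n) = cong₂ (λ y z → 1ℤ * y + z) (f≗g (suc n)) (S-cong f≗g n)

  S-linear : ∀ c f g → S (λ n → c * f n + g n) ≗ λ n → c * S f n + S g n
  S-linear c f g zero    = lem c (f 0) (g 0)
    where
    lem : ∀ c x y → 1ℤ * (c * x + y) + 0ℤ ≡ c * (1ℤ * x + 0ℤ) + (1ℤ * y + 0ℤ)
    lem = solve-∀
  S-linear c f g (suc n) rewrite S-linear c f g n =
    lem c (f (suc n)) (g (suc n)) (S f n) (S g n)
    where
    lem : ∀ c x y s t → 1ℤ * (c * x + y) + (c * s + t) ≡ c * (1ℤ * x + s) + (1ℤ * y + t)
    lem = solve-∀

  S-zero : S (λ _ → 0ℤ) ≗ λ _ → 0ℤ
  S-zero zero    = refl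
  S-zero (suc n) = cong (λ z → 1ℤ * 0ℤ + z) (S-zero n)

  S-combination : ∀ b cs → combination (S ∘ b) cs ≗ S (combination b cs)
  S-combination b []       n = sym (S-zero n)
  S-combination b (c ∷ cs) n
    rewrite S-combination (b ∘ suc) cs n = sym (S-linear c (b 0) (combination (b ∘ suc) cs) n)

  S𝟏 : S 𝟏 ≗ λ _ → 1ℤ
  S𝟏 zero    = refl
  S𝟏 (suc n) = cong (λ z → 1ℤ * 0ℤ + z) (S𝟏 n)

  S-⊙ : ∀ f g → S f ⊙ S g ≗ S (λ n → f n * S g n + S f n * g n - f n * g n)
  S-⊙ f g zero    = lem (f 0) (g 0)
    where
    lem : ∀ x y → (1ℤ * x + 0ℤ) * (1ℤ * y + 0ℤ) ≡
      1ℤ * (x * (1ℤ * y + 0ℤ) + (1ℤ * x + 0ℤ) * y - x * y) + 0ℤ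
    lem = solve-∀
  S-⊙ f g (suc n) = trans (lem (f (suc n)) (g (suc n)) (S f n) (S g n))
    (cong (λ z → 1ℤ * (f (suc n) * S g (suc n) + S f (suc n) * g (suc n)
                       - f (suc n) * g (suc n)) + z) (S-⊙ f g n))
    where
    lem : ∀ x y s t → (1ℤ * x + s) * (1ℤ * y + t) ≡
      1ℤ * (x * (1ℤ * y + t) + (1ℤ * x + s) * y - x * y) + s * t
    lem = solve-∀

  value : List ℤ → Series
  value = combination 1/[1-x]^1+

  value-∷ : ∀ c cs n → value (c ∷ cs) n ≡ c + S (value cs) n
  value-∷ c cs n = cong₂ _+_ (trans (cong (c *_) (S𝟏 n)) (ℤ.*-identityʳ c))
                             (S-combination 1/[1-x]^1+ cs n)

mul-correct : ∀ cs ds →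
  combination 1/[1-x]^1+ (mul cs ds) ≗
  combination 1/[1-x]^1+ cs ⊙ combination 1/[1-x]^1+ ds
private
  shifted-mul-correct : ∀ cs ds → value (shifted-mul cs ds) ≗ S (value cs) ⊙ value ds

mul-correct []       ds n = refl
mul-correct (c ∷ cs) ds n
  rewrite value-∷ c cs n
        | ⊞-correct 1/[1-x]^1+ (scale c ds) (shifted-mul cs ds) n
        | scale-correct 1/[1-x]^1+ c ds n
        | shifted-mul-correct cs ds n
  = sym (ℤ.*-distribʳ-+ (value ds n) c (S (value cs) n))

shifted-mul-correct cs []       n = sym (ℤ.*-zeroʳ (S (value cs) n))
shifted-mul-correct cs (d ∷ ds) n = begin
  value (0ℤ ∷ rest) n                              ≡⟨ value-∷ 0ℤ rest n ⟩
  0ℤ + S (value rest) n                            ≡⟨ ℤ.+-identityˡ _ ⟩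
  S (value rest) n                                 ≡⟨ S-cong rest-value n ⟩
  S (λ m → d * A m + product m) n                  ≡⟨ S-linear d A product n ⟩
  d * S A n + S product n                          ≡⟨ cong (λ z → d * S A n + z) (sym (S-⊙ A B n)) ⟩
  d * S A n + S A n * S B n                        ≡⟨ lem d (S A n) (S B n) ⟩
  S A n * (d + S B n)                              ≡⟨ cong (S A n *_) (sym (value-∷ d ds n)) ⟩
  S A n * value (d ∷ ds) n                         ∎
  where
  open ≡-Reasoning
  A B product : Series
  A = value cs
  B = value ds
  product m = A m * S B m + S A m * B m - A m * B m
  tail₁ rest : List ℤ
  tail₁ = mul cs (0ℤ ∷ ds) ⊞ shifted-mul cs ds
  rest  = scale d cs ⊞ (tail₁ ⊞ scale -1ℤ (mul cs ds))
  lem : ∀ d x y → d * x + x * y ≡ x * (d + y)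
  lem = solve-∀
  lem′ : ∀ a x y z w → a + (x * (0ℤ + y) + z + -1ℤ * w) ≡ a + (x * y + z - w)
  lem′ = solve-∀
  rest-value : value rest ≗ λ m → d * A m + product m
  rest-value m
    rewrite ⊞-correct 1/[1-x]^1+ (scale d cs) (tail₁ ⊞ scale -1ℤ (mul cs ds)) m
          | ⊞-correct 1/[1-x]^1+ tail₁ (scale -1ℤ (mul cs ds)) m
          | ⊞-correct 1/[1-x]^1+ (mul cs (0ℤ ∷ ds)) (shifted-mul cs ds) m
          | scale-correct 1/[1-x]^1+ d cs m
          | scale-correct 1/[1-x]^1+ -1ℤ (mul cs ds) m
          | mul-correct cs (0ℤ ∷ ds) m
          | shifted-mul-correct cs ds m
          | mul-correct cs ds m
          | value-∷ 0ℤ ds m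
    = lem′ (d * A m) (A m) (S B m) (S A m * B m) (A m * B m)

infixl 7 _⊙ˢ_

_⊙ˢ_ : Span 1/[1-x]^1+ → Span 1/[1-x]^1+ → Span 1/[1-x]^1+
f ⊙ˢ g = span (series f ⊙ series g) (mul (coeffs f) (coeffs g)) λ n →
  trans (cong₂ _*_ (expansion f n) (expansion g n))
        (sym (mul-correct (coeffs f) (coeffs g) n))

xℤ[[x]] : Set
xℤ[[x]] = Σ[ f ∈ Series ] f 0 ≡ 0ℤ

-- D is a set of series, included by ι, on which the formulas op-⊔ and op-⊕
-- make sense and which contains the series F P.

module _ {D : Set} (ι : D → Series) (F : FinPoset → Series) where

  Family : Setoid (Level.suc 0ℓ) 0ℓ
  Family = record
    { Carrier       = Σ[ f ∈ D ] Σ[ P ∈ FinPoset ] (IsSP∅ P × ι f ≗ F P)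
    ; _≈_           = λ f g → ι (proj₁ f) ≗ ι (proj₁ g)
    ; isEquivalence = record
      { refl  = λ _ → refl
      ; sym   = λ p n → sym (p n)
      ; trans = λ p q n → trans (p n) (q n) } }

  private module Fam = Setoid Family

  ⌊_⌋ : Fam.Carrier → Series
  ⌊ f ⌋ = ι (proj₁ f)

  record FamilyAlgebra (gen unit : Series) (op-⊔ op-⊕ : D → D → Series) :
                       Set (Level.suc 0ℓ) where
    field
      contains  : ∀ P → IsSP∅ P → Σ[ f ∈ D ] ι f ≗ F P
      algebra   : 𝒮𝒫-Algebra Family

    open 𝒮𝒫-Algebra algebra

    field
      ⊔-formula : ∀ f g → ⌊ act-⊔ f g ⌋ ≗ op-⊔ (proj₁ f) (proj₁ g)
      ⊕-formula : ∀ f g → ⌊ act-⊕ f g ⌋ ≗ op-⊕ (proj₁ f) (proj₁ g)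

      ⊔-series  : ∀ {P Q} → IsSP P → IsSP Q → ∀ f g →
                  ⌊ f ⌋ ≗ F P → ⌊ g ⌋ ≗ F Q → ⌊ act-⊔ f g ⌋ ≗ F (P ⊔ Q)
      ⊕-series  : ∀ {P Q} → IsSP P → IsSP Q → ∀ f g →
                  ⌊ f ⌋ ≗ F P → ⌊ g ⌋ ≗ F Q → ⌊ act-⊕ f g ⌋ ≗ F (P ⊕ Q)

      generator : F pt ≗ gen

      unit-∅    : F ∅ ≗ unit
      ⊔-unit    : ∀ e → ⌊ e ⌋ ≗ unit → Identity Fam._≈_ e act-⊔
      ⊕-unit    : ∀ e → ⌊ e ⌋ ≗ unit → Identity Fam._≈_ e act-⊕

{-# OPTIONS --safe #-}
module Submission where

-- The counting function n ↦ Ω°(P,n) = ∑ dᵢ binom(n,i) determines everything.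
-- A strict map from P ⊔ Q is a pair of strict maps, so Ω° is multiplicative;
-- sorting the strict maps from P ⊕ Q by the maximum a of their restriction to P
-- gives Ω°(P⊕Q,n) = ∑ₐ (Ω°(P,a+1) - Ω°(P,a)) Ω°(Q,n-1-a), that is, the
-- generating functions satisfy F(P⊕Q) = F(P)(1-x)F(Q).  All bases involved
-- are, up to a factor x, of the form bᵢ = tⁱ/(1-x), for which
-- bᵢ(1-x)bⱼ = bᵢ₊ⱼ; hence the formula for ⊕ holds in each of them, with
-- convolution of coefficients.  Products of binomials are expanded by the
-- Leibniz rule for differences, and the same expansion is valid at the
-- arguments -1-n, where binom(-1-n,i) is the coefficient of xⁿ in
-- (-1)ⁱ/(1-x)ⁱ⁺¹; this gives the formula for ⊔.  Finally, two composites of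
-- ⊔ and ⊕ that define the same order on the inputs give isomorphic posets
-- after substitution of posets for the inputs, since both are lexicographic
-- sums over that order.

open import Algebra.Bundles using (CommutativeMonoid)
open import Data.Bool.Base using (if_then_else_)
open import Data.Empty using (⊥; ⊥-elim)
open import Data.Fin.Base
  using (Fin; zero; suc; toℕ; fromℕ<; splitAt; join; combine; remQuot; _↑ˡ_; _↑ʳ_; finToFun; funToFin)
import Data.Fin.Base as Fin
open import Data.Fin.Permutation using (Permutation; permutation; ↔⇒≡)
open import Data.Fin.Properties
  using (_≟_; all?; toℕ-fromℕ<; toℕ-injective; toℕ<n; splitAt-↑ˡ; splitAt-↑ʳ; join-splitAt; +↔⊎;
         remQuot-combine; combine-remQuot; finToFun-funToFin; funToFin-finToFin)
import Data.Fin.Properties as Fin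
open import Data.Integer.Base using (ℤ; +_; _+_; _*_; _-_; 0ℤ; 1ℤ; -1ℤ)
import Data.Integer.Base as ℤ
import Data.Integer.Properties as ℤ
open import Data.Integer.Tactic.RingSolver using (solve-∀)
open import Data.List.Base using (List; []; _∷_; length; filter; tabulate)
open import Data.List.Properties using (length-map)
open import Data.List.Relation.Unary.All using (All; []; _∷_)
open import Data.Nat.Base using (ℕ; zero; suc; _∸_; pred; z≤n; s≤s)
import Data.Nat.Base as ℕ
open import Data.Nat.Combinatorics using (_C_; nCk+nC[k+1]≡[n+1]C[k+1]; nC1≡n)
import Data.Nat.Properties as ℕ
open import Data.Product.Base using (∃; Σ-syntax; _×_; _,_; proj₁; proj₂)
open import Data.Product.Function.Dependent.Propositional using (Σ-↔)
open import Data.Sum.Base using (_⊎_; inj₁; inj₂; [_,_]′)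
open import Data.Sum.Function.Propositional using (_⊎-↔_)
open import Data.Sum.Relation.Binary.LeftOrder using (_⊎-<_; ₁∼₂; ₁∼₁; ₂∼₂)
open import Data.Sum.Relation.Binary.Pointwise using (Pointwise; inj₁; inj₂)
open import Data.Vec.Functional using (_++_)
open import Function.Base using (_∘_; id)
open import Function.Bundles using (_↔_; _⇔_; Inverse; mk⤖; mk↔ₛ′; mk⇔)
open import Function.Construct.Composition using (_↔-∘_)
open import Function.Construct.Identity using (↔-id)
open import Function.Construct.Symmetry using (↔-sym)
open import Function.Properties.Bijection using (⤖⇒↔)
open import Level using (0ℓ)
open import Relation.Binary.Bundles using (Setoid)
open import Relation.Binary.Core using (Rel)
open import Relation.Binary.Definitions using (tri<; tri≈; tri>)
open import Relation.Binary.Morphism.Structures using (IsOrderIsomorphism)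
open import Relation.Binary.PropositionalEquality
open import Relation.Binary.Structures using (IsPartialOrder)
open import Relation.Nullary.Decidable using (Dec; yes; no; does; _×-dec_)
open import Relation.Nullary.Negation using (contradiction)
open import Algebra.Properties.Semiring.Sum ℤ.+-*-semiring
  using (sum-cong-≗; sum-permute; ∑-comm; *-distribˡ-sum; *-distribʳ-sum; sum-replicate-zero)
open import Defs

open FinPoset using (size)

-- Power series

-- A series determines its coefficient list only up to trailing zeros, so equal series do not give
-- equal lists. Linear independence therefore enters as `change-of-basis`: two lists with the same
-- series in one independent basis have the same series in every basis. This makes any admissible
-- `d` interchangeable with any list that expands Ω°, and it makes `ψ` depend only on the series
-- although it acts on a stored list. The sign (-1)^(|P|-i) is split into (-1)^|P|, multiplicative
-- because sizes add under both operations, and (-1)^i, which is absorbed into the basis. Sorting by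
-- the maximum requires P to be nonempty; for empty P the formula for ⊕ holds because the series
-- 1/(1-x) of Ω°(∅,n) cancels the factor 1-x. An element of a family carries a poset, but equality
-- compares only series. The operations respect this equality because their formulas see only the
-- series.

·-cong : ∀ {f f′ g g′} → f ≗ f′ → g ≗ g′ → f · g ≗ f′ · g′
·-cong p q n = sum-cong-≗ {n = suc n} λ k → cong₂ _*_ (p (toℕ k)) (q (n ∸ toℕ k))

·-congˡ : ∀ h {f g} → f ≗ g → h · f ≗ h · g
·-congˡ h {f} {g} p = ·-cong {h} {h} {f} {g} (λ _ → refl) p

·-congʳ : ∀ h {f g} → f ≗ g → f · h ≗ g · h
·-congʳ h {f} {g} p = ·-cong {f} {g} {h} {h} p (λ _ → refl)

-- By definition `(f · g) (suc n)` is `f 0 * g (suc n)` plus `((f ∘ suc) · g) n`; the inductions on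
-- convolutions follow this recursion.
·-linearˡ : ∀ c f g h → (λ n → c * f n + g n) · h ≗ λ n → c * (f · h) n + (g · h) n
·-linearˡ c f g h zero    = lem c (f 0) (g 0) (h 0)
  where
  lem : ∀ c x y z → (c * x + y) * z + 0ℤ ≡ c * (x * z + 0ℤ) + (y * z + 0ℤ)
  lem = solve-∀
·-linearˡ c f g h (suc n) rewrite ·-linearˡ c (f ∘ suc) (g ∘ suc) h n =
  lem c (f 0) (g 0) (h (suc n)) _ _
  where
  lem : ∀ c x y z s t → (c * x + y) * z + (c * s + t) ≡ c * (x * z + s) + (y * z + t)
  lem = solve-∀

·-zeroˡ : ∀ h → (λ _ → 0ℤ) · h ≗ λ _ → 0ℤ
·-zeroˡ h zero    = refl
·-zeroˡ h (suc n) = trans (ℤ.+-identityˡ _) (·-zeroˡ h n)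

·-identityˡ : ∀ f → 𝟏 · f ≗ f
·-identityˡ f zero    = lem (f 0)
  where
  lem : ∀ x → 1ℤ * x + 0ℤ ≡ x
  lem = solve-∀
·-identityˡ f (suc n) rewrite ·-zeroˡ f n = lem (f (suc n))
  where
  lem : ∀ x → 1ℤ * x + 0ℤ ≡ x
  lem = solve-∀

-- Peels off the last term of the convolution instead of the first, which is what commutativity
-- needs to exchange the two factors.
·-sucʳ : ∀ f g n → (f · g) (suc n) ≡ f (suc n) * g 0 + (f · (g ∘ suc)) n
·-sucʳ f g zero    = lem (f 0) (f 1) (g 0) (g 1)
  where
  lem : ∀ a b c d → a * d + (b * c + 0ℤ) ≡ b * c + (a * d + 0ℤ)
  lem = solve-∀
·-sucʳ f g (suc n) rewrite ·-sucʳ (f ∘ suc) g n =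
  lem (f 0 * g (suc (suc n))) (f (suc (suc n)) * g 0) _
  where
  lem : ∀ a b c → a + (b + c) ≡ b + (a + c)
  lem = solve-∀

·-comm : ∀ f g → f · g ≗ g · f
·-comm f g zero    = cong (_+ 0ℤ) (ℤ.*-comm (f 0) (g 0))
·-comm f g (suc n) = trans (cong₂ _+_ (ℤ.*-comm (f 0) (g (suc n))) (·-comm (f ∘ suc) g n))
                           (sym (·-sucʳ g f n))

·-assoc : ∀ f g h → (f · g) · h ≗ f · (g · h)
·-assoc f g h zero    = lem (f 0) (g 0) (h 0)
  where
  lem : ∀ x y z → (x * y + 0ℤ) * z + 0ℤ ≡ x * (y * z + 0ℤ) + 0ℤ
  lem = solve-∀
·-assoc f g h (suc n)
  -- `(f · g) ∘ suc` is by definition `f 0` times `g ∘ suc` plus `(f ∘ suc) · g`, the shape that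
  -- `·-linearˡ` takes.
  rewrite ·-linearˡ (f 0) (g ∘ suc) ((f ∘ suc) · g) h n
        | ·-assoc (f ∘ suc) g h n = lem (f 0) (g 0) (h (suc n)) _ _
  where
  lem : ∀ x y z s t → (x * y + 0ℤ) * z + (x * s + t) ≡ x * (y * z + s) + t
  lem = solve-∀

·-identityʳ : ∀ f → f · 𝟏 ≗ f
·-identityʳ f n = trans (·-comm f 𝟏 n) (·-identityˡ f n)

·-𝟏-commutativeMonoid : CommutativeMonoid 0ℓ 0ℓ
·-𝟏-commutativeMonoid = record
  { Carrier = Series ; _≈_ = _≗_ ; _∙_ = _·_ ; ε = 𝟏
  ; isCommutativeMonoid = record
    { isMonoid = record
      { isSemigroup = record
        { isMagma = record
          { isEquivalence = record
            { refl = λ _ → refl ; sym = λ p n → sym (p n) ; trans = λ p q n → trans (p n) (q n) }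
          ; ∙-cong = ·-cong }
        ; assoc = ·-assoc }
      ; identity = ·-identityˡ , ·-identityʳ }
    ; comm = ·-comm } }

open import Algebra.Solver.CommutativeMonoid ·-𝟏-commutativeMonoid
  using (solve; _⊜_) renaming (_⊕_ to _⊗_)


·-scaleˡ : ∀ c f g → (λ n → c * f n) · g ≗ λ n → c * (f · g) n
·-scaleˡ c f g n = begin
  ((λ n → c * f n) · g) n             ≡⟨ ·-congʳ g (λ n → sym (ℤ.+-identityʳ (c * f n))) n ⟩
  ((λ n → c * f n + 0ℤ) · g) n        ≡⟨ ·-linearˡ c f (λ _ → 0ℤ) g n ⟩
  c * (f · g) n + ((λ _ → 0ℤ) · g) n  ≡⟨ cong (λ z → c * (f · g) n + z) (·-zeroˡ g n) ⟩
  c * (f · g) n + 0ℤ                  ≡⟨ ℤ.+-identityʳ _ ⟩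
  c * (f · g) n                       ∎
  where open ≡-Reasoning

·-scaleʳ : ∀ c f g → f · (λ n → c * g n) ≗ λ n → c * (f · g) n
·-scaleʳ c f g n = trans (·-comm f (λ n → c * g n) n)
  (trans (·-scaleˡ c g f n) (cong (c *_) (·-comm g f n)))

𝐱·-suc : ∀ f n → (𝐱 · f) (suc n) ≡ f n
𝐱·-suc f n = trans (ℤ.+-identityˡ _)
  (trans (·-congʳ f {𝐱 ∘ suc} {𝟏} (λ { zero → refl ; (suc _) → refl }) n) (·-identityˡ f n))

1-x·-suc : ∀ f n → (1-x · f) (suc n) ≡ f (suc n) - f n
1-x·-suc f n = begin
  1ℤ * f (suc n) + ((1-x ∘ suc) · f) n    ≡⟨ cong (λ z → 1ℤ * f (suc n) + z)
                                               (·-congʳ f {1-x ∘ suc} {λ n → -1ℤ * 𝟏 n} (λ { zero → refl ; (suc _) → refl }) n) ⟩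
  1ℤ * f (suc n) + ((λ n → -1ℤ * 𝟏 n) · f) n  ≡⟨ cong (λ z → 1ℤ * f (suc n) + z) (·-scaleˡ -1ℤ 𝟏 f n) ⟩
  1ℤ * f (suc n) + -1ℤ * (𝟏 · f) n        ≡⟨ cong (λ z → 1ℤ * f (suc n) + -1ℤ * z) (·-identityˡ f n) ⟩
  1ℤ * f (suc n) + -1ℤ * f n              ≡⟨ lem (f (suc n)) (f n) ⟩
  f (suc n) - f n                         ∎
  where
  open ≡-Reasoning
  lem : ∀ x y → 1ℤ * x + -1ℤ * y ≡ x - y
  lem = solve-∀

-- Finite combinations

combination-cong : ∀ {b b′} m n → (∀ i → b i m ≡ b′ i n) →
                   ∀ cs → combination b cs m ≡ combination b′ cs n
combination-cong m n eq []       = refl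
combination-cong m n eq (c ∷ cs) =
  cong₂ _+_ (cong (c *_) (eq 0)) (combination-cong m n (eq ∘ suc) cs)

-- Three separate points of evaluation are allowed because recurrences of Pascal type relate values
-- at `n` and at `suc n`.
combination-linear : ∀ a {b b′ b″} m n k → (∀ i → b i m ≡ b′ i n + a * b″ i k) →
                     ∀ cs → combination b cs m ≡ combination b′ cs n + a * combination b″ cs k
combination-linear a m n k eq [] = sym (trans (ℤ.+-identityˡ _) (ℤ.*-zeroʳ a))
combination-linear a {b} {b′} {b″} m n k eq (c ∷ cs)
  rewrite eq 0 | combination-linear a {b ∘ suc} {b′ ∘ suc} {b″ ∘ suc} m n k (eq ∘ suc) cs =
  lem a c (b′ 0 n) (b″ 0 k) _ _
  where
  lem : ∀ a c x y s t → c * (x + a * y) + (s + a * t) ≡ (c * x + s) + a * (c * y + t)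
  lem = solve-∀

combination-scale : ∀ a {b b′} m n → (∀ i → b i m ≡ a * b′ i n) →
                    ∀ cs → combination b cs m ≡ a * combination b′ cs n
combination-scale a m n eq [] = sym (ℤ.*-zeroʳ a)
combination-scale a {b} {b′} m n eq (c ∷ cs)
  rewrite eq 0 | combination-scale a {b ∘ suc} {b′ ∘ suc} m n (eq ∘ suc) cs = lem a c (b′ 0 n) _
  where
  lem : ∀ a c x s → c * (a * x) + a * s ≡ a * (c * x + s)
  lem = solve-∀

combination-vanishing : ∀ {b} n cs → (∀ i → i ℕ.< length cs → b i n ≡ 0ℤ) → combination b cs n ≡ 0ℤ
combination-vanishing n []       eq = refl
combination-vanishing n (c ∷ cs) eq = trans
  (cong₂ (λ y z → c * y + z) (eq 0 ℕ.z<s) (combination-vanishing n cs (λ i i< → eq (suc i) (ℕ.s<s i<))))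
  (trans (ℤ.+-identityʳ _) (ℤ.*-zeroʳ c))

⊞-combination : ∀ b cs ds n →
  combination b (cs ⊞ ds) n ≡ combination b cs n + combination b ds n
⊞-combination b []       ds       n = sym (ℤ.+-identityˡ _)
⊞-combination b (c ∷ cs) []       n = sym (ℤ.+-identityʳ _)
⊞-combination b (c ∷ cs) (d ∷ ds) n rewrite ⊞-combination (b ∘ suc) cs ds n = lem c d (b 0 n) _ _
  where
  lem : ∀ c d x y z → (c + d) * x + (y + z) ≡ (c * x + y) + (d * x + z)
  lem = solve-∀

⊞-⊞-combination : ∀ b cs ds es n → combination b (cs ⊞ (ds ⊞ es)) n ≡
  combination b cs n + (combination b ds n + combination b es n)
⊞-⊞-combination b cs ds es n = trans (⊞-combination b cs (ds ⊞ es) n)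
  (cong (λ z → combination b cs n + z) (⊞-combination b ds es n))

scale-combination : ∀ b a cs n → combination b (scale a cs) n ≡ a * combination b cs n
scale-combination b a []       n = sym (ℤ.*-zeroʳ a)
scale-combination b a (c ∷ cs) n rewrite scale-combination (b ∘ suc) a cs n = lem a c (b 0 n) _
  where
  lem : ∀ a c x y → a * c * x + a * y ≡ a * (c * x + y)
  lem = solve-∀

·-combinationˡ : ∀ b cs g → combination b cs · g ≗ combination (λ i → b i · g) cs
·-combinationˡ b []       g n = ·-zeroˡ g n
·-combinationˡ b (c ∷ cs) g n = trans (·-linearˡ c (b 0) (combination (b ∘ suc) cs) g n)
  (cong (λ z → c * (b 0 · g) n + z) (·-combinationˡ (b ∘ suc) cs g n))

·-combinationʳ : ∀ b cs f → f · combination b cs ≗ combination (λ i → f · b i) cs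
·-combinationʳ b cs f n = trans (·-comm f (combination b cs) n)
  (trans (·-combinationˡ b cs f n) (combination-cong n n (λ i → ·-comm (b i) f n) cs))

conv : List ℤ → List ℤ → List ℤ
conv []       ds = []
conv (c ∷ cs) ds = scale c ds ⊞ (0ℤ ∷ conv cs ds)

conv-combination : ∀ b cs ds n → combination b (conv cs ds) n ≡
                   combination (λ i → combination (λ j → b (i ℕ.+ j)) ds) cs n
conv-combination b []       ds n = refl
conv-combination b (c ∷ cs) ds n
  rewrite ⊞-combination b (scale c ds) (0ℤ ∷ conv cs ds) n
        | scale-combination b c ds n
        | conv-combination (b ∘ suc) cs ds n = cong (λ z → c * combination b ds n + z) (ℤ.+-identityˡ _)

-- Geometric bases: b i = t ^ i / (1 - x)

record Geometric (b : ℕ → Series) : Set where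
  field
    ratio  : Series
    b-zero : b 0 ≗ 1/[1-x]
    b-suc  : ∀ i → b (suc i) ≗ ratio · b i

open Geometric

1/[1-x]·1-x· : ∀ f → 1/[1-x] · 1-x · f ≗ f
1/[1-x]·1-x· f n = trans (·-congʳ f (λ m → trans (·-comm 1/[1-x] 1-x m) (1/[1-x]-inverse m)) n)
                         (·-identityˡ f n)

geometric-· : ∀ {b} → Geometric b → ∀ i j → b i · 1-x · b j ≗ b (i ℕ.+ j)
geometric-· {b} G zero    j n = trans
  (·-congʳ (b j) (·-congʳ 1-x (b-zero G)) n) (1/[1-x]·1-x· (b j) n)
geometric-· {b} G (suc i) j n = begin
  (b (suc i) · 1-x · b j) n             ≡⟨ ·-congʳ (b j) (·-congʳ 1-x (b-suc G i)) n ⟩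
  (ratio G · b i · 1-x · b j) n         ≡⟨ ·-congʳ (b j) (·-assoc (ratio G) (b i) 1-x) n ⟩
  (ratio G · (b i · 1-x) · b j) n       ≡⟨ ·-assoc (ratio G) (b i · 1-x) (b j) n ⟩
  (ratio G · (b i · 1-x · b j)) n       ≡⟨ ·-congˡ (ratio G) (geometric-· G i j) n ⟩
  (ratio G · b (i ℕ.+ j)) n             ≡⟨ b-suc G (i ℕ.+ j) n ⟨
  b (suc (i ℕ.+ j)) n                   ∎
  where open ≡-Reasoning

geometric-conv : ∀ {b} → Geometric b → ∀ cs ds →
                 combination b (conv cs ds) ≗ combination b cs · 1-x · combination b ds
geometric-conv {b} G cs ds n = sym (begin
  (combination b cs · 1-x · combination b ds) n
    ≡⟨ ·-congʳ (combination b ds) (·-combinationˡ b cs 1-x) n ⟩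
  (combination (λ i → b i · 1-x) cs · combination b ds) n
    ≡⟨ ·-combinationˡ (λ i → b i · 1-x) cs (combination b ds) n ⟩
  combination (λ i → b i · 1-x · combination b ds) cs n
    ≡⟨ combination-cong n n (λ i → trans (·-combinationʳ b ds (b i · 1-x) n)
         (combination-cong n n (λ j → geometric-· G i j n) ds)) cs ⟩
  combination (λ i → combination (λ j → b (i ℕ.+ j)) ds) cs n
    ≡⟨ conv-combination b cs ds n ⟨
  combination b (conv cs ds) n ∎)
  where open ≡-Reasoning

alternating : (ℕ → Series) → ℕ → Series
alternating b i n = -1ℤ ℤ.^ i * b i n

-- The sign (-1)^i turns the ratio t into -t, so the formula for ⊕ in signed bases needs no separate
-- proof.
alternating-geometric : ∀ {b} → Geometric b → Geometric (alternating b)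
alternating-geometric {b} G = record
  { ratio  = λ n → -1ℤ * ratio G n
  ; b-zero = λ n → trans (ℤ.*-identityˡ _) (b-zero G n)
  ; b-suc  = λ i n → begin
      -1ℤ * -1ℤ ℤ.^ i * b (suc i) n                           ≡⟨ cong (-1ℤ * -1ℤ ℤ.^ i *_) (b-suc G i n) ⟩
      -1ℤ * -1ℤ ℤ.^ i * (ratio G · b i) n                     ≡⟨ ℤ.*-assoc -1ℤ (-1ℤ ℤ.^ i) _ ⟩
      -1ℤ * (-1ℤ ℤ.^ i * (ratio G · b i) n)                   ≡⟨ cong (-1ℤ *_) (·-scaleʳ (-1ℤ ℤ.^ i) (ratio G) (b i) n) ⟨
      -1ℤ * (ratio G · alternating b i) n                     ≡⟨ ·-scaleˡ -1ℤ (ratio G) (alternating b i) n ⟨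
      ((λ n → -1ℤ * ratio G n) · alternating b i) n           ∎ }
  where open ≡-Reasoning

1/[1-x]^1+-geometric : Geometric 1/[1-x]^1+
1/[1-x]^1+-geometric = record
  { ratio = 1/[1-x] ; b-zero = ·-identityʳ 1/[1-x] ; b-suc = λ _ _ → refl }

-- The exceptional entry `1/[1-x]` at index 0 fits the pattern, since 1-x times it is `𝟏`, the entry
-- at index 1.
[1-x]^-1+-geometric : Geometric [1-x]^-1+
[1-x]^-1+-geometric = record
  { ratio = 1-x ; b-zero = λ _ → refl
  ; b-suc = λ { zero n → sym (1/[1-x]-inverse n) ; (suc _) _ → refl } }

-- Binomial coefficients as a geometric basis

binomial : ℕ → Series
binomial i n = + (n C i)

pascal : ∀ i n → binomial (suc i) (suc n) ≡ binomial i n + binomial (suc i) n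
pascal i n = cong +_ (sym (nCk+nC[k+1]≡[n+1]C[k+1] n i))

nC0≡1 : ∀ n → n C 0 ≡ 1
nC0≡1 zero = refl
nC0≡1 (suc n) = refl

-- The generating function of binom(n,i) is x^i/(1-x)^(i+1), whence the ratio x/(1-x).
-- Multiplication by 1/(1-x) takes partial sums, which the hockey-stick identity evaluates.
binomial-geometric : Geometric binomial
binomial-geometric = record
  { ratio  = 𝐱 · 1/[1-x]
  ; b-zero = λ n → cong +_ (nC0≡1 n)
  ; b-suc  = λ i n → sym (trans (·-assoc 𝐱 1/[1-x] (binomial i) n) (step i n)) }
  where
  partial-sums : ∀ i n → (1/[1-x] · binomial i) n ≡ binomial (suc i) (suc n)
  partial-sums i zero    = trans (cong (_+ 0ℤ) (ℤ.*-identityˡ (binomial i 0))) (sym (pascal i 0))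
  partial-sums i (suc n) = trans (cong₂ _+_ (ℤ.*-identityˡ (binomial i (suc n))) (partial-sums i n)) (sym (pascal i (suc n)))
  step : ∀ i n → (𝐱 · (1/[1-x] · binomial i)) n ≡ binomial (suc i) n
  step i zero    = refl
  step i (suc n) = trans (𝐱·-suc (1/[1-x] · binomial i) n) (partial-sums i n)

-- Hadamard products

binomial-∷-zero : ∀ c cs → combination binomial (c ∷ cs) 0 ≡ c
binomial-∷-zero c cs = trans
  (cong₂ _+_ (ℤ.*-identityʳ c) (combination-vanishing 0 cs (λ _ _ → refl))) (ℤ.+-identityʳ c)

-- Pascal's rule: the forward difference lowers each binomial index by one, hence drops the head of
-- the list.
binomial-∷-suc : ∀ c cs n → combination binomial (c ∷ cs) (suc n) ≡
                 combination binomial (c ∷ cs) n + combination binomial cs n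
binomial-∷-suc c cs n = begin
  c * 1ℤ + combination (binomial ∘ suc) cs (suc n)
    ≡⟨ cong₂ (λ y z → c * + y + z) (sym (nC0≡1 n)) (combination-linear 1ℤ {b″ = binomial} (suc n) n n
         (λ i → trans (pascal i n) (lem (binomial i n) (binomial (suc i) n))) cs) ⟩
  c * binomial 0 n + (combination (binomial ∘ suc) cs n + 1ℤ * combination binomial cs n)
    ≡⟨ lem′ (c * binomial 0 n) _ _ ⟩
  c * binomial 0 n + combination (binomial ∘ suc) cs n + combination binomial cs n ∎
  where
  open ≡-Reasoning
  lem : ∀ x y → x + y ≡ y + 1ℤ * x
  lem = solve-∀
  lem′ : ∀ x y z → x + (y + 1ℤ * z) ≡ x + y + z
  lem′ = solve-∀

1/[1-x]^1+-0 : ∀ n → 1/[1-x]^1+ 0 n ≡ 1ℤ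
1/[1-x]^1+-0 n = ·-identityʳ 1/[1-x] n

-- Each basis series consists of the partial sums of the previous one. The tail is evaluated at
-- `suc n`: here it is the backward difference that drops the head.
1/[1-x]^1+-∷-suc : ∀ c cs n → combination 1/[1-x]^1+ (c ∷ cs) (suc n) ≡
  combination 1/[1-x]^1+ (c ∷ cs) n + combination 1/[1-x]^1+ cs (suc n)
1/[1-x]^1+-∷-suc c cs n = begin
  c * 1/[1-x]^1+ 0 (suc n) + combination (1/[1-x]^1+ ∘ suc) cs (suc n)
    ≡⟨ cong₂ (λ y z → c * y + z) (trans (1/[1-x]^1+-0 (suc n)) (sym (1/[1-x]^1+-0 n)))
         (combination-linear 1ℤ {b″ = 1/[1-x]^1+} (suc n) n (suc n) (λ i → ℤ.+-comm (1ℤ * 1/[1-x]^1+ i (suc n)) _) cs) ⟩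
  c * 1/[1-x]^1+ 0 n + (combination (1/[1-x]^1+ ∘ suc) cs n + 1ℤ * combination 1/[1-x]^1+ cs (suc n))
    ≡⟨ lem (c * 1/[1-x]^1+ 0 n) _ _ ⟩
  c * 1/[1-x]^1+ 0 n + combination (1/[1-x]^1+ ∘ suc) cs n + combination 1/[1-x]^1+ cs (suc n) ∎
  where
  open ≡-Reasoning
  lem : ∀ x y z → x + (y + 1ℤ * z) ≡ x + y + z
  lem = solve-∀

-- The value of negative-binomial i at n is binom(-1-n,i).
negative-binomial : ℕ → Series
negative-binomial = alternating 1/[1-x]^1+

-- The polynomial p with these binomial coefficients has p(0) = c, and index 0 stands for the
-- argument -1; this is p(-1) = p(0) - Δp(-1).
negative-binomial-∷-zero : ∀ c cs → combination negative-binomial (c ∷ cs) 0 ≡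
                           c - combination negative-binomial cs 0
negative-binomial-∷-zero c cs = trans
  (cong (λ z → c * 1ℤ + z) (combination-scale -1ℤ {b′ = negative-binomial} 0 0 (λ i → lem (-1ℤ ℤ.^ i) (1/[1-x]^1+ i 0)) cs))
  (lem′ c _)
  where
  lem : ∀ s x → -1ℤ * s * (1ℤ * x + 0ℤ) ≡ -1ℤ * (s * x)
  lem = solve-∀
  lem′ : ∀ x y → x * 1ℤ + -1ℤ * y ≡ x - y
  lem′ = solve-∀

-- The rule p(y+1) = p(y) + Δp(y) at y = -2-n.
negative-binomial-∷-suc : ∀ c cs n → combination negative-binomial (c ∷ cs) (suc n) ≡
  combination negative-binomial (c ∷ cs) n - combination negative-binomial cs (suc n)
negative-binomial-∷-suc c cs n = begin
  c * negative-binomial 0 (suc n) + combination (negative-binomial ∘ suc) cs (suc n)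
    ≡⟨ cong₂ (λ y z → c * (1ℤ * y) + z) (trans (1/[1-x]^1+-0 (suc n)) (sym (1/[1-x]^1+-0 n)))
         (combination-linear -1ℤ {b″ = negative-binomial} (suc n) n (suc n)
           (λ i → lem (-1ℤ ℤ.^ i) (1/[1-x]^1+ i (suc n)) (1/[1-x]^1+ (suc i) n)) cs) ⟩
  c * negative-binomial 0 n + (combination (negative-binomial ∘ suc) cs n + -1ℤ * combination negative-binomial cs (suc n))
    ≡⟨ lem′ (c * negative-binomial 0 n) _ _ ⟩
  c * negative-binomial 0 n + combination (negative-binomial ∘ suc) cs n - combination negative-binomial cs (suc n) ∎
  where
  open ≡-Reasoning
  lem : ∀ s x y → -1ℤ * s * (1ℤ * x + y) ≡ -1ℤ * s * y + -1ℤ * (s * x)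
  lem = solve-∀
  lem′ : ∀ x y z → x + (y + -1ℤ * z) ≡ x + y - z
  lem′ = solve-∀

-- Δ (p q) = p Δq + Δp q + Δp Δq, where Δ drops the first binomial coefficient.
binomial-mul : List ℤ → List ℤ → List ℤ
binomial-mul []       ds       = []
binomial-mul (c ∷ cs) []       = []
binomial-mul (c ∷ cs) (d ∷ ds) =
  c * d ∷ (binomial-mul (c ∷ cs) ds ⊞ (binomial-mul cs (d ∷ ds) ⊞ binomial-mul cs ds))

-- By the Leibniz rule `r` and `p ⊙ q` have the same differences, and they agree at 0.
forward-product : ∀ (p p′ q q′ r r′ : Series) → r 0 ≡ p 0 * q 0 →
  (∀ n → p (suc n) ≡ p n + p′ n) → (∀ n → q (suc n) ≡ q n + q′ n) → (∀ n → r (suc n) ≡ r n + r′ n) →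
  (∀ n → r′ n ≡ p n * q′ n + (p′ n * q n + p′ n * q′ n)) → r ≗ p ⊙ q
forward-product p p′ q q′ r r′ r₀ Δp Δq Δr eq zero    = r₀
forward-product p p′ q q′ r r′ r₀ Δp Δq Δr eq (suc n)
  rewrite Δp n | Δq n | Δr n | eq n | forward-product p p′ q q′ r r′ r₀ Δp Δq Δr eq n =
  lem (p n) (q n) (p′ n) (q′ n)
  where
  lem : ∀ p q p′ q′ → p * q + (p * q′ + (p′ * q + p′ * q′)) ≡ (p + p′) * (q + q′)
  lem = solve-∀

binomial-mul-correct : ∀ cs ds → combination binomial (binomial-mul cs ds) ≗
  combination binomial cs ⊙ combination binomial ds
binomial-mul-correct [] ds n = refl
binomial-mul-correct (c ∷ cs) [] n = sym (ℤ.*-zeroʳ (combination binomial (c ∷ cs) n))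
binomial-mul-correct (c ∷ cs) (d ∷ ds) = forward-product
  (combination binomial (c ∷ cs)) (combination binomial cs)
  (combination binomial (d ∷ ds)) (combination binomial ds)
  (combination binomial (c * d ∷ rest)) (combination binomial rest)
  (trans (binomial-∷-zero (c * d) rest) (sym (cong₂ _*_ (binomial-∷-zero c cs) (binomial-∷-zero d ds))))
  (binomial-∷-suc c cs) (binomial-∷-suc d ds) (binomial-∷-suc (c * d) rest) λ n →
  trans (⊞-⊞-combination binomial (binomial-mul (c ∷ cs) ds) (binomial-mul cs (d ∷ ds)) (binomial-mul cs ds) n)
  (cong₂ _+_ (binomial-mul-correct (c ∷ cs) ds n)
  (cong₂ _+_ (binomial-mul-correct cs (d ∷ ds) n)
             (binomial-mul-correct cs ds n)))
  where
  rest = binomial-mul (c ∷ cs) ds ⊞ (binomial-mul cs (d ∷ ds) ⊞ binomial-mul cs ds)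

-- The same argument walking down through -1, -2, ...: the differences, and so the Leibniz formula,
-- are taken at the new point `suc n`.
backward-product : ∀ (p p′ q q′ r r′ : Series) → r 0 ≡ p 0 * q 0 →
  (∀ n → p (suc n) ≡ p n - p′ (suc n)) → (∀ n → q (suc n) ≡ q n - q′ (suc n)) →
  (∀ n → r (suc n) ≡ r n - r′ (suc n)) →
  (∀ n → r′ n ≡ p n * q′ n + (p′ n * q n + p′ n * q′ n)) → r ≗ p ⊙ q
backward-product p p′ q q′ r r′ r₀ Δp Δq Δr eq zero    = r₀
backward-product p p′ q q′ r r′ r₀ Δp Δq Δr eq (suc n)
  rewrite Δr n | eq (suc n) | Δp n | Δq n | backward-product p p′ q q′ r r′ r₀ Δp Δq Δr eq n =
  lem (p n) (q n) (p′ (suc n)) (q′ (suc n))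
  where
  lem : ∀ p q p′ q′ → p * q - ((p - p′) * q′ + (p′ * (q - q′) + p′ * q′)) ≡ (p - p′) * (q - q′)
  lem = solve-∀

negative-binomial-mul-∷ : ∀ c cs d ds rest →
  let p = combination negative-binomial (c ∷ cs) ; p′ = combination negative-binomial cs
      q = combination negative-binomial (d ∷ ds) ; q′ = combination negative-binomial ds in
  (∀ n → combination negative-binomial rest n ≡ p n * q′ n + (p′ n * q n + p′ n * q′ n)) →
  combination negative-binomial (c * d ∷ rest) ≗ p ⊙ q
negative-binomial-mul-∷ c cs d ds rest rest-value = backward-product p p′ q q′ r r′ at-zero
  (negative-binomial-∷-suc c cs) (negative-binomial-∷-suc d ds) (negative-binomial-∷-suc (c * d) rest) rest-value
  where
  open ≡-Reasoning
  p p′ q q′ r r′ : Series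
  p  = combination negative-binomial (c ∷ cs)
  p′ = combination negative-binomial cs
  q  = combination negative-binomial (d ∷ ds)
  q′ = combination negative-binomial ds
  r  = combination negative-binomial (c * d ∷ rest)
  r′ = combination negative-binomial rest
  lem : ∀ c d p′ q′ → c * d - ((c - p′) * q′ + (p′ * (d - q′) + p′ * q′)) ≡ (c - p′) * (d - q′)
  lem = solve-∀
  -- Index 0 is the argument -1, so the initial value takes one backward step from the argument 0,
  -- where the three polynomials have the values `c`, `d` and `c * d`.
  at-zero : r 0 ≡ p 0 * q 0
  at-zero = begin
    r 0                                                        ≡⟨ negative-binomial-∷-zero (c * d) rest ⟩
    c * d - r′ 0                                               ≡⟨ cong (λ z → c * d - z) (rest-value 0) ⟩
    c * d - (p 0 * q′ 0 + (p′ 0 * q 0 + p′ 0 * q′ 0))          ≡⟨ cong₂ (λ x y → c * d - (x * q′ 0 + (p′ 0 * y + p′ 0 * q′ 0)))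
                                                                    (negative-binomial-∷-zero c cs) (negative-binomial-∷-zero d ds) ⟩
    c * d - ((c - p′ 0) * q′ 0 + (p′ 0 * (d - q′ 0) + p′ 0 * q′ 0))  ≡⟨ lem c d (p′ 0) (q′ 0) ⟩
    (c - p′ 0) * (d - q′ 0)                                    ≡⟨ cong₂ _*_ (negative-binomial-∷-zero c cs)
                                                                             (negative-binomial-∷-zero d ds) ⟨
    p 0 * q 0                                                  ∎

negative-binomial-mul-correct : ∀ cs ds → combination negative-binomial (binomial-mul cs ds) ≗
  combination negative-binomial cs ⊙ combination negative-binomial ds
negative-binomial-mul-correct [] ds n = refl
negative-binomial-mul-correct (c ∷ cs) [] n = sym (ℤ.*-zeroʳ (combination negative-binomial (c ∷ cs) n))
negative-binomial-mul-correct (c ∷ cs) (d ∷ ds) = negative-binomial-mul-∷ c cs d ds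
  (binomial-mul (c ∷ cs) ds ⊞ (binomial-mul cs (d ∷ ds) ⊞ binomial-mul cs ds)) λ n → trans
  (⊞-⊞-combination negative-binomial (binomial-mul (c ∷ cs) ds) (binomial-mul cs (d ∷ ds)) (binomial-mul cs ds) n)
  (cong₂ _+_ (negative-binomial-mul-correct (c ∷ cs) ds n)
  (cong₂ _+_ (negative-binomial-mul-correct cs (d ∷ ds) n)
             (negative-binomial-mul-correct cs ds n)))

-- Linear independence of the bases

-- Vanishing of all entries, rather than emptiness of the list, allows for trailing zeros.
Independent : (ℕ → Series) → Set
Independent b = ∀ cs → combination b cs ≗ (λ _ → 0ℤ) → All (_≡ 0ℤ) cs

combination-zero : ∀ b {cs} → All (_≡ 0ℤ) cs → combination b cs ≗ λ _ → 0ℤ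
combination-zero b []           n = refl
combination-zero b (refl ∷ cs≡0) n = trans (ℤ.+-identityˡ _) (combination-zero (b ∘ suc) cs≡0 n)

-- The difference list represents zero in `b`, so its entries vanish and it represents zero in every
-- `b′`.
change-of-basis : ∀ {b} → Independent b → ∀ cs ds → combination b cs ≗ combination b ds →
                  ∀ b′ → combination b′ cs ≗ combination b′ ds
change-of-basis {b} indep cs ds eq b′ n = ℤ.i-j≡0⇒i≡j _ _
  (trans (sym (difference b′ n)) (combination-zero b′ (indep (cs ⊞ scale -1ℤ ds) vanishes) n))
  where
  lem : ∀ x y → x + -1ℤ * y ≡ x - y
  lem = solve-∀
  difference : ∀ b n → combination b (cs ⊞ scale -1ℤ ds) n ≡ combination b cs n - combination b ds n
  difference b n rewrite ⊞-combination b cs (scale -1ℤ ds) n | scale-combination b -1ℤ ds n =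
    lem (combination b cs n) (combination b ds n)
  vanishes : combination b (cs ⊞ scale -1ℤ ds) ≗ λ _ → 0ℤ
  vanishes n = trans (difference b n) (ℤ.i≡j⇒i-j≡0 (eq n))

-- The value at 0 is the head; the forward difference then removes it.
binomial-independent : Independent binomial
binomial-independent []       eq = []
binomial-independent (c ∷ cs) eq =
  trans (sym (binomial-∷-zero c cs)) (eq 0) ∷ binomial-independent cs λ n → begin
    combination binomial cs n                                        ≡⟨ lem (combination binomial (c ∷ cs) n) _ ⟩
    combination binomial (c ∷ cs) n + combination binomial cs n - combination binomial (c ∷ cs) n
      ≡⟨ cong₂ _-_ (trans (sym (binomial-∷-suc c cs n)) (eq (suc n))) (eq n) ⟩
    0ℤ                                                               ∎
  where
  open ≡-Reasoning
  lem : ∀ x y → y ≡ x + y - x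
  lem = solve-∀

1/[1-x]^1+-independent : Independent 1/[1-x]^1+
1/[1-x]^1+-independent cs eq = eventually 0 cs λ n _ → eq n
  where
  open ≡-Reasoning
  b = 1/[1-x]^1+
  lem : ∀ x y → y ≡ x + y - x
  lem = solve-∀
  -- A backward difference says nothing about the first point, so the induction assumes vanishing
  -- only from `N` on and loses one point per step. The head is found last, as the constant left
  -- once the tail is zero.
  eventually : ∀ N cs → (∀ n → N ℕ.≤ n → combination b cs n ≡ 0ℤ) → All (_≡ 0ℤ) cs
  eventually N []       eq = []
  eventually N (c ∷ cs) eq = c≡0 ∷ cs≡0
    where
    cs≡0 : All (_≡ 0ℤ) cs
    cs≡0 = eventually (suc N) cs λ { (suc n) (ℕ.s≤s N≤n) → begin
      combination b cs (suc n)  ≡⟨ lem (combination b (c ∷ cs) n) _ ⟩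
      combination b (c ∷ cs) n + combination b cs (suc n) - combination b (c ∷ cs) n
        ≡⟨ cong₂ _-_ (trans (sym (1/[1-x]^1+-∷-suc c cs n)) (eq (suc n) (ℕ.m≤n⇒m≤1+n N≤n))) (eq n N≤n) ⟩
      0ℤ                        ∎ }
    c≡0 : c ≡ 0ℤ
    c≡0 = begin
      c                                   ≡⟨ ℤ.*-identityʳ c ⟨
      c * 1ℤ                              ≡⟨ cong (c *_) (1/[1-x]^1+-0 N) ⟨
      c * b 0 N                           ≡⟨ ℤ.+-identityʳ _ ⟨
      c * b 0 N + 0ℤ                      ≡⟨ cong (λ z → c * b 0 N + z) (combination-zero (b ∘ suc) cs≡0 N) ⟨
      combination b (c ∷ cs) N            ≡⟨ eq N ℕ.≤-refl ⟩
      0ℤ                                  ∎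

1-x^-degree : ∀ {i n} → i ℕ.< n → (1-x ^ i) n ≡ 0ℤ
1-x^-degree {zero}  {suc n} _ = refl
1-x^-degree {suc i} {suc n} (ℕ.s<s i<n) = trans (1-x·-suc (1-x ^ i) n)
  (cong₂ _-_ (1-x^-degree (ℕ.m<n⇒m<1+n i<n)) (1-x^-degree i<n))

-- All entries except the first are polynomials, of degree below `length cs`, while `1/[1-x]` has
-- every coefficient 1: the coefficient at `length cs` is therefore `c`. Dividing the remaining
-- polynomial by 1-x restores the original basis for the tail.
[1-x]^-1+-independent : Independent [1-x]^-1+
[1-x]^-1+-independent []       eq = []
[1-x]^-1+-independent (c ∷ cs) eq = c≡0 ∷ [1-x]^-1+-independent cs λ n → begin
    combination [1-x]^-1+ cs n                          ≡⟨ combination-cong n n (λ i → divide i n) cs ⟩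
    combination (λ i → 1/[1-x] · 1-x ^ i) cs n          ≡⟨ ·-combinationʳ (1-x ^_) cs 1/[1-x] n ⟨
    (1/[1-x] · combination (1-x ^_) cs) n               ≡⟨ ·-congˡ 1/[1-x] polynomial≡0 n ⟩
    (1/[1-x] · (λ _ → 0ℤ)) n                            ≡⟨ ·-comm 1/[1-x] (λ _ → 0ℤ) n ⟩
    ((λ _ → 0ℤ) · 1/[1-x]) n                            ≡⟨ ·-zeroˡ 1/[1-x] n ⟩
    0ℤ                                                  ∎
  where
  open ≡-Reasoning
  c≡0 : c ≡ 0ℤ
  c≡0 = begin
    c             ≡⟨ ℤ.*-identityʳ c ⟨
    c * 1ℤ        ≡⟨ ℤ.+-identityʳ _ ⟨
    c * 1ℤ + 0ℤ   ≡⟨ cong (λ z → c * 1ℤ + z)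
                       (combination-vanishing {1-x ^_} (length cs) cs (λ _ → 1-x^-degree)) ⟨
    combination [1-x]^-1+ (c ∷ cs) (length cs)  ≡⟨ eq (length cs) ⟩
    0ℤ            ∎
  polynomial≡0 : combination (1-x ^_) cs ≗ λ _ → 0ℤ
  polynomial≡0 n = trans (sym (trans (cong (λ z → z * 1ℤ + combination (1-x ^_) cs n) c≡0) (ℤ.+-identityˡ _))) (eq n)
  divide : ∀ i → [1-x]^-1+ i ≗ 1/[1-x] · 1-x ^ i
  divide zero    n = sym (·-identityʳ 1/[1-x] n)
  divide (suc i) n = sym (trans (sym (·-assoc 1/[1-x] 1-x (1-x ^ i) n)) (1/[1-x]·1-x· (1-x ^ i) n))

-- Isomorphisms of strict orders

↔-injective : ∀ {A B : Set} (f : A ↔ B) {x y} → Inverse.to f x ≡ Inverse.to f y → x ≡ y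
↔-injective f eq = trans (sym (Inverse.strictlyInverseʳ f _))
  (trans (cong (Inverse.from f) eq) (Inverse.strictlyInverseʳ f _))

infix 4 _≃_

-- Arbitrary carriers are allowed because the chains of isomorphisms pass through sum types and
-- Σ-types, not only through `Fin n`.
record _≃_ {A B : Set} (R : Rel A 0ℓ) (S : Rel B 0ℓ) : Set where
  field
    bijection : A ↔ B

  open Inverse bijection public using (to; from; strictlyInverseˡ; strictlyInverseʳ)

  field
    mono   : ∀ {x y} → R x y → S (to x) (to y)
    cancel : ∀ {x y} → S (to x) (to y) → R x y

  injective : ∀ {x y} → to x ≡ to y → x ≡ y
  injective = ↔-injective bijection

module _ {A : Set} {R : Rel A 0ℓ} where

  ≃-refl : R ≃ R
  ≃-refl = record { bijection = ↔-id _ ; mono = λ r → r ; cancel = λ r → r }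

  ≃-sym : {B : Set} {S : Rel B 0ℓ} → R ≃ S → S ≃ R
  ≃-sym {S = S} θ = record
    { bijection = ↔-sym bijection
    ; mono      = λ s → cancel (subst₂ S (sym (strictlyInverseˡ _)) (sym (strictlyInverseˡ _)) s)
    ; cancel    = λ r → subst₂ S (strictlyInverseˡ _) (strictlyInverseˡ _) (mono r) }
    where open _≃_ θ

  ≃-trans : {B B′ : Set} {S : Rel B 0ℓ} {T : Rel B′ 0ℓ} → R ≃ S → S ≃ T → R ≃ T
  ≃-trans θ η = record
    { bijection = _≃_.bijection η ↔-∘ _≃_.bijection θ
    ; mono      = λ r → _≃_.mono η (_≃_.mono θ r)
    ; cancel    = λ t → _≃_.cancel θ (_≃_.cancel η t) }

infix 4 _≈ₒ_

_≈ₒ_ : FinPoset → FinPoset → Set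
P ≈ₒ Q = FinPoset._<_ P ≃ FinPoset._<_ Q

≅⇒≈ₒ : ∀ P Q → P ≅ Q → P ≈ₒ Q
≅⇒≈ₒ P Q (φ , iso) = record
  { bijection = ⤖⇒↔ (mk⤖ (injective , surjective))
  ; mono      = λ (x≤y , x≢y) → mono x≤y , λ eq → x≢y (injective eq)
  ; cancel    = λ (x≤y , x≢y) → cancel x≤y , λ eq → x≢y (cong φ eq) }
  where open IsOrderIsomorphism iso hiding (cong)

≈ₒ⇒≅ : ∀ P Q → P ≈ₒ Q → P ≅ Q
≈ₒ⇒≅ P Q θ = to , record
  { isOrderMonomorphism = record
    { isOrderHomomorphism = record { cong = cong to ; mono = mono-≤ }
    ; injective           = injective
    ; cancel              = cancel-≤ }
  ; surjective = λ y → from y , λ { refl → strictlyInverseˡ y } }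
  where
  open _≃_ θ
  module P = FinPoset P
  module Q = FinPoset Q
  mono-≤ : ∀ {x y} → x P.≤ y → to x Q.≤ to y
  mono-≤ {x} {y} x≤y with x ≟ y
  ... | yes refl = IsPartialOrder.refl Q.isPartialOrder
  ... | no x≢y   = proj₁ (mono (x≤y , x≢y))
  cancel-≤ : ∀ {x y} → to x Q.≤ to y → x P.≤ y
  cancel-≤ {x} {y} x≤y with x ≟ y
  ... | yes refl = IsPartialOrder.refl P.isPartialOrder
  ... | no x≢y   = proj₁ (cancel (x≤y , λ eq → x≢y (injective eq)))

module _ {A B A′ B′ : Set} {R : Rel A 0ℓ} {S : Rel B 0ℓ} {R′ : Rel A′ 0ℓ} {S′ : Rel B′ 0ℓ}
         (θ : R ≃ R′) (η : S ≃ S′) where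

  private
    module θ = _≃_ θ
    module η = _≃_ η

  Pointwise-≃ : Pointwise R S ≃ Pointwise R′ S′
  Pointwise-≃ = record
    { bijection = θ.bijection ⊎-↔ η.bijection
    ; mono      = λ { (inj₁ r) → inj₁ (θ.mono r) ; (inj₂ s) → inj₂ (η.mono s) }
    ; cancel    = cancel _ _ }
    where
    cancel : ∀ x y → Pointwise R′ S′ (Inverse.to (θ.bijection ⊎-↔ η.bijection) x)
                                     (Inverse.to (θ.bijection ⊎-↔ η.bijection) y) → Pointwise R S x y
    cancel (inj₁ x) (inj₁ y) (inj₁ r) = inj₁ (θ.cancel r)
    cancel (inj₂ x) (inj₂ y) (inj₂ s) = inj₂ (η.cancel s)

  ⊎-<-≃ : (R ⊎-< S) ≃ (R′ ⊎-< S′)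
  ⊎-<-≃ = record
    { bijection = θ.bijection ⊎-↔ η.bijection
    ; mono      = λ { ₁∼₂ → ₁∼₂ ; (₁∼₁ r) → ₁∼₁ (θ.mono r) ; (₂∼₂ s) → ₂∼₂ (η.mono s) }
    ; cancel    = cancel _ _ }
    where
    cancel : ∀ x y → (R′ ⊎-< S′) (Inverse.to (θ.bijection ⊎-↔ η.bijection) x)
                                 (Inverse.to (θ.bijection ⊎-↔ η.bijection) y) → (R ⊎-< S) x y
    cancel (inj₁ x) (inj₁ y) (₁∼₁ r) = ₁∼₁ (θ.cancel r)
    cancel (inj₁ x) (inj₂ y) ₁∼₂     = ₁∼₂
    cancel (inj₂ x) (inj₂ y) (₂∼₂ s) = ₂∼₂ (η.cancel s)

module _ (P Q : FinPoset) where

  private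
    module P = FinPoset P
    module Q = FinPoset Q

  ⊔-<-≃ : FinPoset._<_ (P ⊔ Q) ≃ Pointwise P._<_ Q._<_
  ⊔-<-≃ = record
    { bijection = +↔⊎
    ; mono      = λ (i≤j , i≢j) → strict i≤j λ eq → i≢j (↔-injective +↔⊎ eq)
    ; cancel    = λ i<j → proj₁ (non-strict i<j) , λ eq → proj₂ (non-strict i<j) (cong (splitAt P.size) eq) }
    where
    strict : ∀ {u v} → Pointwise P._≤_ Q._≤_ u v → u ≢ v → Pointwise P._<_ Q._<_ u v
    strict (inj₁ x≤y) u≢v = inj₁ (x≤y , λ eq → u≢v (cong inj₁ eq))
    strict (inj₂ x≤y) u≢v = inj₂ (x≤y , λ eq → u≢v (cong inj₂ eq))
    non-strict : ∀ {u v} → Pointwise P._<_ Q._<_ u v → Pointwise P._≤_ Q._≤_ u v × u ≢ v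
    non-strict (inj₁ (x≤y , x≢y)) = inj₁ x≤y , λ { refl → x≢y refl }
    non-strict (inj₂ (x≤y , x≢y)) = inj₂ x≤y , λ { refl → x≢y refl }

  ⊕-<-≃ : FinPoset._<_ (P ⊕ Q) ≃ (P._<_ ⊎-< Q._<_)
  ⊕-<-≃ = record
    { bijection = +↔⊎
    ; mono      = λ (i≤j , i≢j) → strict i≤j λ eq → i≢j (↔-injective +↔⊎ eq)
    ; cancel    = λ i<j → proj₁ (non-strict i<j) , λ eq → proj₂ (non-strict i<j) (cong (splitAt P.size) eq) }
    where
    strict : ∀ {u v} → (P._≤_ ⊎-< Q._≤_) u v → u ≢ v → (P._<_ ⊎-< Q._<_) u v
    strict ₁∼₂       u≢v = ₁∼₂
    strict (₁∼₁ x≤y) u≢v = ₁∼₁ (x≤y , λ eq → u≢v (cong inj₁ eq))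
    strict (₂∼₂ x≤y) u≢v = ₂∼₂ (x≤y , λ eq → u≢v (cong inj₂ eq))
    non-strict : ∀ {u v} → (P._<_ ⊎-< Q._<_) u v → (P._≤_ ⊎-< Q._≤_) u v × u ≢ v
    non-strict ₁∼₂               = ₁∼₂ , λ ()
    non-strict (₁∼₁ (x≤y , x≢y)) = ₁∼₁ x≤y , λ { refl → x≢y refl }
    non-strict (₂∼₂ (x≤y , x≢y)) = ₂∼₂ x≤y , λ { refl → x≢y refl }

⊔-cong : ∀ P P′ Q Q′ → P ≈ₒ P′ → Q ≈ₒ Q′ → P ⊔ Q ≈ₒ P′ ⊔ Q′
⊔-cong P P′ Q Q′ θ η = ≃-trans (⊔-<-≃ P Q) (≃-trans (Pointwise-≃ θ η) (≃-sym (⊔-<-≃ P′ Q′)))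

⊕-cong : ∀ P P′ Q Q′ → P ≈ₒ P′ → Q ≈ₒ Q′ → P ⊕ Q ≈ₒ P′ ⊕ Q′
⊕-cong P P′ Q Q′ θ η = ≃-trans (⊕-<-≃ P Q) (≃-trans (⊎-<-≃ θ η) (≃-sym (⊕-<-≃ P′ Q′)))

-- Sums with the empty poset, and closure of the index class

module _ {B : Set} (R : Rel (Fin 0) 0ℓ) (S : Rel B 0ℓ) where

  private
    dropˡ : (Fin 0 ⊎ B) ↔ B
    dropˡ = mk↔ₛ′ (λ { (inj₂ y) → y }) inj₂ (λ _ → refl) λ { (inj₂ y) → refl }

    dropʳ : (B ⊎ Fin 0) ↔ B
    dropʳ = mk↔ₛ′ (λ { (inj₁ y) → y }) inj₁ (λ _ → refl) λ { (inj₁ y) → refl }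

  Pointwise-emptyˡ : Pointwise R S ≃ S
  Pointwise-emptyˡ = record
    { bijection = dropˡ ; mono = λ { (inj₂ s) → s } ; cancel = λ { {inj₂ _} {inj₂ _} s → inj₂ s } }

  Pointwise-emptyʳ : Pointwise S R ≃ S
  Pointwise-emptyʳ = record
    { bijection = dropʳ ; mono = λ { (inj₁ s) → s } ; cancel = λ { {inj₁ _} {inj₁ _} s → inj₁ s } }

  ⊎-<-emptyˡ : (R ⊎-< S) ≃ S
  ⊎-<-emptyˡ = record
    { bijection = dropˡ ; mono = λ { (₂∼₂ s) → s } ; cancel = λ { {inj₂ _} {inj₂ _} s → ₂∼₂ s } }

  ⊎-<-emptyʳ : (S ⊎-< R) ≃ S
  ⊎-<-emptyʳ = record
    { bijection = dropʳ ; mono = λ { (₁∼₁ s) → s } ; cancel = λ { {inj₁ _} {inj₁ _} s → ₁∼₁ s } }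

⊔-emptyˡ : ∀ E → ∅ ≈ₒ E → ∀ P → E ⊔ P ≈ₒ P
⊔-emptyˡ E e P = ≃-trans (⊔-cong E ∅ P P (≃-sym e) ≃-refl) (≃-trans (⊔-<-≃ ∅ P) (Pointwise-emptyˡ _ _))

⊔-emptyʳ : ∀ E → ∅ ≈ₒ E → ∀ P → P ⊔ E ≈ₒ P
⊔-emptyʳ E e P = ≃-trans (⊔-cong P P E ∅ ≃-refl (≃-sym e)) (≃-trans (⊔-<-≃ P ∅) (Pointwise-emptyʳ _ _))

⊕-emptyˡ : ∀ E → ∅ ≈ₒ E → ∀ P → E ⊕ P ≈ₒ P
⊕-emptyˡ E e P = ≃-trans (⊕-cong E ∅ P P (≃-sym e) ≃-refl) (≃-trans (⊕-<-≃ ∅ P) (⊎-<-emptyˡ _ _))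

⊕-emptyʳ : ∀ E → ∅ ≈ₒ E → ∀ P → P ⊕ E ≈ₒ P
⊕-emptyʳ E e P = ≃-trans (⊕-cong P P E ∅ ≃-refl (≃-sym e)) (≃-trans (⊕-<-≃ P ∅) (⊎-<-emptyʳ _ _))

IsSP∅-resp : ∀ P Q → P ≈ₒ Q → IsSP∅ P → IsSP∅ Q
IsSP∅-resp P Q θ (inj₁ (t , t≅P)) = inj₁ (t , ≈ₒ⇒≅ ⟦ t ⟧ Q (≃-trans (≅⇒≈ₒ ⟦ t ⟧ P t≅P) θ))
IsSP∅-resp P Q θ (inj₂ ∅≅P)       = inj₂ (≈ₒ⇒≅ ∅ Q (≃-trans (≅⇒≈ₒ ∅ P ∅≅P) θ))

-- No expression denotes the empty poset, so an empty summand has to be absorbed by isomorphism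
-- before expressions can be joined.
⊔-IsSP∅ : ∀ P Q → IsSP∅ P → IsSP∅ Q → IsSP∅ (P ⊔ Q)
⊔-IsSP∅ P Q (inj₂ e) q = IsSP∅-resp Q (P ⊔ Q) (≃-sym (⊔-emptyˡ P (≅⇒≈ₒ ∅ P e) Q)) q
⊔-IsSP∅ P Q p@(inj₁ _) (inj₂ e) = IsSP∅-resp P (P ⊔ Q) (≃-sym (⊔-emptyʳ Q (≅⇒≈ₒ ∅ Q e) P)) p
⊔-IsSP∅ P Q (inj₁ (s , s≅P)) (inj₁ (t , t≅Q)) = inj₁ (s ⊔ᵉ t ,
  ≈ₒ⇒≅ (⟦ s ⟧ ⊔ ⟦ t ⟧) (P ⊔ Q) (⊔-cong ⟦ s ⟧ P ⟦ t ⟧ Q (≅⇒≈ₒ ⟦ s ⟧ P s≅P) (≅⇒≈ₒ ⟦ t ⟧ Q t≅Q)))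

⊕-IsSP∅ : ∀ P Q → IsSP∅ P → IsSP∅ Q → IsSP∅ (P ⊕ Q)
⊕-IsSP∅ P Q (inj₂ e) q = IsSP∅-resp Q (P ⊕ Q) (≃-sym (⊕-emptyˡ P (≅⇒≈ₒ ∅ P e) Q)) q
⊕-IsSP∅ P Q p@(inj₁ _) (inj₂ e) = IsSP∅-resp P (P ⊕ Q) (≃-sym (⊕-emptyʳ Q (≅⇒≈ₒ ∅ Q e) P)) p
⊕-IsSP∅ P Q (inj₁ (s , s≅P)) (inj₁ (t , t≅Q)) = inj₁ (s ⊕ᵉ t ,
  ≈ₒ⇒≅ (⟦ s ⟧ ⊕ ⟦ t ⟧) (P ⊕ Q) (⊕-cong ⟦ s ⟧ P ⟦ t ⟧ Q (≅⇒≈ₒ ⟦ s ⟧ P s≅P) (≅⇒≈ₒ ⟦ t ⟧ Q t≅Q)))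

-- Substitution of posets for the leaves of an expression is the
-- lexicographic sum over the poset of the expression.

data Lex {I : Set} (R : Rel I 0ℓ) (F : I → FinPoset) : Rel (Σ[ i ∈ I ] Fin (size (F i))) 0ℓ where
  across : ∀ {i j x y} → R i j → Lex R F (i , x) (j , y)
  within : ∀ {i x y} → FinPoset._<_ (F i) x y → Lex R F (i , x) (i , y)

-- Matching on `within` at indices `to i` and `to j` would require unifying them; the inversion
-- returns that equation as data.
Lex-inversion : ∀ {I R F i j x y} → Lex {I} R F (i , x) (j , y) →
  R i j ⊎ Σ[ e ∈ i ≡ j ] FinPoset._<_ (F j) (subst (λ k → Fin (size (F k))) e x) y
Lex-inversion (across r)   = inj₁ r
Lex-inversion (within x<y) = inj₂ (refl , x<y)

Lex-reindex : ∀ {I J : Set} {R : Rel I 0ℓ} {S : Rel J 0ℓ} {F G} (θ : R ≃ S) →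
              (∀ i → G (_≃_.to θ i) ≡ F i) → Lex R F ≃ Lex S G
Lex-reindex {I} {J} {R} {S} {F} {G} θ eq = record
  { bijection = Σ-↔ bijection λ {i} → fibre i
  ; mono      = λ { (across r) → across (mono r) ; (within {i} x<y) → within (fibre-mono (eq i) x<y) }
  ; cancel    = λ { {i , x} {j , y} l → [ (λ s → across (cancel s)) , (λ (e , x<y) → same x y e x<y) ]′ (Lex-inversion l) } }
  where
  open _≃_ θ
  coerce : ∀ {P Q} → Q ≡ P → Fin (size P) ↔ Fin (size Q)
  coerce refl = ↔-id _
  fibre : ∀ i → Fin (size (F i)) ↔ Fin (size (G (to i)))
  fibre i = coerce (eq i)
  fibre-mono : ∀ {P Q} (e : Q ≡ P) {x y} → FinPoset._<_ P x y →
               FinPoset._<_ Q (Inverse.to (coerce e) x) (Inverse.to (coerce e) y)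
  fibre-mono refl x<y = x<y
  fibre-cancel : ∀ {P Q} (e : Q ≡ P) {x y} →
                 FinPoset._<_ Q (Inverse.to (coerce e) x) (Inverse.to (coerce e) y) → FinPoset._<_ P x y
  fibre-cancel refl x<y = x<y
  same : ∀ {i j} x y (e : to i ≡ to j) →
         FinPoset._<_ (G (to j)) (subst (λ k → Fin (size (G k))) e (Inverse.to (fibre i) x)) (Inverse.to (fibre j) y) →
         Lex R F (i , x) (j , y)
  -- Injectivity identifies `i` with `j`; then `e` is a loop at `to i`, and matching it with `refl`
  -- removes the `subst`.
  same x y e x<y with refl ← injective e | refl ← e = within (fibre-cancel (eq _) x<y)

module _ {A B : Set} {R : Rel A 0ℓ} {S : Rel B 0ℓ} (F : A ⊎ B → FinPoset) where

  private
    split : (Σ[ i ∈ A ⊎ B ] Fin (size (F i))) ↔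
            ((Σ[ a ∈ A ] Fin (size (F (inj₁ a)))) ⊎ (Σ[ b ∈ B ] Fin (size (F (inj₂ b)))))
    split = mk↔ₛ′ (λ { (inj₁ a , x) → inj₁ (a , x) ; (inj₂ b , x) → inj₂ (b , x) })
      (λ { (inj₁ (a , x)) → inj₁ a , x ; (inj₂ (b , x)) → inj₂ b , x })
      (λ { (inj₁ _) → refl ; (inj₂ _) → refl })
      (λ { (inj₁ _ , _) → refl ; (inj₂ _ , _) → refl })

  Lex-Pointwise : Lex (Pointwise R S) F ≃ Pointwise (Lex R (F ∘ inj₁)) (Lex S (F ∘ inj₂))
  Lex-Pointwise = record { bijection = split ; mono = mono ; cancel = λ {u} {v} → cancel u v }
    where
    mono : ∀ {u v} → Lex (Pointwise R S) F u v → Pointwise (Lex R (F ∘ inj₁)) (Lex S (F ∘ inj₂))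
                                                           (Inverse.to split u) (Inverse.to split v)
    mono (across (inj₁ r))    = inj₁ (across r)
    mono (across (inj₂ s))    = inj₂ (across s)
    mono (within {inj₁ _} x<y) = inj₁ (within x<y)
    mono (within {inj₂ _} x<y) = inj₂ (within x<y)
    cancel : ∀ u v → Pointwise (Lex R (F ∘ inj₁)) (Lex S (F ∘ inj₂)) (Inverse.to split u) (Inverse.to split v) →
             Lex (Pointwise R S) F u v
    cancel (inj₁ _ , _) (inj₁ _ , _) (inj₁ (across r))   = across (inj₁ r)
    cancel (inj₁ _ , _) (inj₁ _ , _) (inj₁ (within x<y)) = within x<y
    cancel (inj₂ _ , _) (inj₂ _ , _) (inj₂ (across s))   = across (inj₂ s)
    cancel (inj₂ _ , _) (inj₂ _ , _) (inj₂ (within x<y)) = within x<y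

  Lex-⊎-< : Lex (R ⊎-< S) F ≃ (Lex R (F ∘ inj₁) ⊎-< Lex S (F ∘ inj₂))
  Lex-⊎-< = record { bijection = split ; mono = mono ; cancel = λ {u} {v} → cancel u v }
    where
    mono : ∀ {u v} → Lex (R ⊎-< S) F u v → (Lex R (F ∘ inj₁) ⊎-< Lex S (F ∘ inj₂))
                                                           (Inverse.to split u) (Inverse.to split v)
    mono (across ₁∼₂)         = ₁∼₂
    mono (across (₁∼₁ r))     = ₁∼₁ (across r)
    mono (across (₂∼₂ s))     = ₂∼₂ (across s)
    mono (within {inj₁ _} x<y) = ₁∼₁ (within x<y)
    mono (within {inj₂ _} x<y) = ₂∼₂ (within x<y)
    cancel : ∀ u v → (Lex R (F ∘ inj₁) ⊎-< Lex S (F ∘ inj₂)) (Inverse.to split u) (Inverse.to split v) →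
             Lex (R ⊎-< S) F u v
    cancel (inj₁ _ , _) (inj₁ _ , _) (₁∼₁ (across r))   = across (₁∼₁ r)
    cancel (inj₁ _ , _) (inj₁ _ , _) (₁∼₁ (within x<y)) = within x<y
    cancel (inj₁ _ , _) (inj₂ _ , _) ₁∼₂                = across ₁∼₂
    cancel (inj₂ _ , _) (inj₂ _ , _) (₂∼₂ (across s))   = across (₂∼₂ s)
    cancel (inj₂ _ , _) (inj₂ _ , _) (₂∼₂ (within x<y)) = within x<y

substitute : ∀ {X} → Expr X → (X → FinPoset) → FinPoset
substitute = eval _⊔_ _⊕_

-- Induction on the expression: lexicographic sums commute with both ways of joining the index
-- orders, and over one point the lexicographic sum is the fibre.
substitute-Lex : ∀ {X} (t : Expr X) (P : X → FinPoset) →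
  FinPoset._<_ (substitute t P) ≃ Lex (FinPoset._<_ ⟦ t ⟧) (P ∘ label t)
substitute-Lex (leaf x) P = record
  { bijection = mk↔ₛ′ (zero ,_) proj₂ (λ { (zero , _) → refl ; (suc () , _) }) λ _ → refl
  ; mono      = within
  ; cancel    = λ { (across (_ , 0≢0)) → ⊥-elim (0≢0 refl) ; (within x<y) → x<y } }
substitute-Lex (s ⊔ᵉ t) P =
  ≃-trans (⊔-<-≃ (substitute s P) (substitute t P))
  (≃-trans (Pointwise-≃ (substitute-Lex s P) (substitute-Lex t P))
  (≃-trans (≃-sym (Lex-Pointwise (P ∘ [ label s , label t ]′)))
  -- `label` is defined through `splitAt`, the forward map of `⊔-<-≃`, so the two families of fibres
  -- agree by computation.
  (≃-sym (Lex-reindex (⊔-<-≃ ⟦ s ⟧ ⟦ t ⟧) λ _ → refl))))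
substitute-Lex (s ⊕ᵉ t) P =
  ≃-trans (⊕-<-≃ (substitute s P) (substitute t P))
  (≃-trans (⊎-<-≃ (substitute-Lex s P) (substitute-Lex t P))
  (≃-trans (≃-sym (Lex-⊎-< (P ∘ [ label s , label t ]′)))
  (≃-sym (Lex-reindex (⊕-<-≃ ⟦ s ⟧ ⟦ t ⟧) λ _ → refl))))

substitute-≐ : ∀ {n} {σ τ : 𝒮𝒫 n} → σ ≐ τ → ∀ P → substitute (expr σ) P ≈ₒ substitute (expr τ) P
substitute-≐ {σ = σ} {τ} (φ , labels) P = ≃-trans (substitute-Lex (expr σ) P)
  (≃-trans (Lex-reindex (≅⇒≈ₒ ⟦ expr σ ⟧ ⟦ expr τ ⟧ φ) λ i → cong P (labels i))
  (≃-sym (substitute-Lex (expr τ) P)))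

-- Indicators and finite sums

𝟙 : {A : Set} → Dec A → ℤ
𝟙 a? = if does a? then 1ℤ else 0ℤ

𝟙-yes : {A : Set} (a? : Dec A) → A → 𝟙 a? ≡ 1ℤ
𝟙-yes (yes _) a = refl
𝟙-yes (no ¬a) a = contradiction a ¬a

𝟙-no : {A : Set} (a? : Dec A) → (A → ⊥) → 𝟙 a? ≡ 0ℤ
𝟙-no (yes a) ¬a = contradiction a ¬a
𝟙-no (no _)  ¬a = refl

𝟙-cong : {A B : Set} (a? : Dec A) (b? : Dec B) → (A → B) → (B → A) → 𝟙 a? ≡ 𝟙 b?
𝟙-cong (yes a) b? f g = sym (𝟙-yes b? (f a))
𝟙-cong (no ¬a) b? f g = sym (𝟙-no b? (¬a ∘ g))

𝟙-× : {A B : Set} (a? : Dec A) (b? : Dec B) → 𝟙 (a? ×-dec b?) ≡ 𝟙 a? * 𝟙 b?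
𝟙-× (yes _) (yes _) = refl
𝟙-× (yes _) (no _)  = refl
𝟙-× (no _)  b?      = refl

length-filter-tabulate : ∀ {A : Set} {P : A → Set} (P? : ∀ a → Dec (P a)) {n} (f : Fin n → A) →
                         + length (filter P? (tabulate f)) ≡ ∑[ i < n ] 𝟙 (P? (f i))
length-filter-tabulate P? {zero}  f = refl
length-filter-tabulate P? {suc n} f with P? (f zero)
... | yes _ = cong (λ z → 1ℤ + z) (length-filter-tabulate P? (f ∘ suc))
... | no _  = trans (length-filter-tabulate P? (f ∘ suc)) (sym (ℤ.+-identityˡ _))

sum-zero : ∀ {n} (f : Fin n → ℤ) → (∀ i → f i ≡ 0ℤ) → sum f ≡ 0ℤ
sum-zero {n} f eq = trans (sum-cong-≗ eq) (sum-replicate-zero n)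

sum-one : ∀ {n} (f : Fin n → ℤ) → (∀ i → f i ≡ 1ℤ) → sum f ≡ + n
sum-one {zero}  f eq = refl
sum-one {suc n} f eq = cong₂ _+_ (eq zero) (sum-one (f ∘ suc) (eq ∘ suc))

sum-delta : ∀ {n} (j : Fin n) (h : Fin n → ℤ) → ∑[ i < n ] (𝟙 (j ≟ i) * h i) ≡ h j
sum-delta zero    h = trans
  (cong₂ _+_ (ℤ.*-identityˡ (h zero)) (sum-zero (λ i → 0ℤ * h (suc i)) λ _ → refl)) (ℤ.+-identityʳ _)
sum-delta (suc j) h = trans (ℤ.+-identityˡ _) (sum-delta j (h ∘ suc))

-- The indicator of `U` at `i` is the number of preimages of `i` under the injection `E`; exchanging
-- the two sums leaves one term for each `j`.
sum-image : ∀ {a b} (E : Fin a → Fin b) → (∀ {i j} → E i ≡ E j → i ≡ j) →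
            {U : Fin b → Set} (U? : ∀ i → Dec (U i)) →
            (∀ j → U (E j)) → (∀ i → U i → ∃ λ j → E j ≡ i) →
            ∀ h → ∑[ i < b ] (𝟙 (U? i) * h i) ≡ ∑[ j < a ] h (E j)
sum-image {a} {b} E injective {U} U? sound complete h = begin
  ∑[ i < b ] (𝟙 (U? i) * h i)                      ≡⟨ sum-cong-≗ (λ i → cong (_* h i) (fibre i (U? i))) ⟩
  ∑[ i < b ] (∑[ j < a ] 𝟙 (E j ≟ i) * h i)        ≡⟨ sum-cong-≗ (λ i → *-distribʳ-sum (h i) (λ j → 𝟙 (E j ≟ i))) ⟩
  ∑[ i < b ] ∑[ j < a ] (𝟙 (E j ≟ i) * h i)        ≡⟨ ∑-comm (λ i j → 𝟙 (E j ≟ i) * h i) ⟩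
  ∑[ j < a ] ∑[ i < b ] (𝟙 (E j ≟ i) * h i)        ≡⟨ sum-cong-≗ (λ j → sum-delta (E j) h) ⟩
  ∑[ j < a ] h (E j)                               ∎
  where
  open ≡-Reasoning
  fibre : ∀ i (u? : Dec (U i)) → 𝟙 u? ≡ ∑[ j < a ] 𝟙 (E j ≟ i)
  fibre i (no ¬u) = sym (sum-zero (λ j → 𝟙 (E j ≟ i)) λ j → 𝟙-no (E j ≟ i) λ { refl → ¬u (sound j) })
  fibre i (yes u) with j₀ , refl ← complete i u = sym (trans
    (sum-cong-≗ λ j → trans (𝟙-cong (E j ≟ E j₀) (j₀ ≟ j) (sym ∘ injective) (cong E ∘ sym))
                            (sym (ℤ.*-identityʳ _)))
    (sum-delta j₀ (λ _ → 1ℤ)))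

sum-split : ∀ m n (h : Fin (m ℕ.+ n) → ℤ) → sum h ≡ ∑[ i < m ] h (i ↑ˡ n) + ∑[ j < n ] h (m ↑ʳ j)
sum-split zero    n h = sym (ℤ.+-identityˡ _)
sum-split (suc m) n h = trans (cong (λ z → h zero + z) (sum-split m n (h ∘ suc))) (sym (ℤ.+-assoc (h zero) _ _))

sum-combine : ∀ m n (h : Fin (m ℕ.* n) → ℤ) → sum h ≡ ∑[ i < m ] ∑[ j < n ] h (combine i j)
sum-combine zero    n h = refl
sum-combine (suc m) n h = trans (sum-split n (m ℕ.* n) h)
  (cong (λ z → ∑[ j < n ] h (j ↑ˡ (m ℕ.* n)) + z) (sum-combine m n (λ k → h (n ↑ʳ k))))

sum-* : ∀ {m n} (f : Fin m → ℤ) (g : Fin n → ℤ) → ∑[ i < m ] ∑[ j < n ] (f i * g j) ≡ sum f * sum g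
sum-* {m} f g = trans (sum-cong-≗ λ i → sym (*-distribˡ-sum (f i) g)) (sym (*-distribʳ-sum (sum g) f))

-- Sums over maps between finite sets

∑ᴹ : ∀ m n → ((Fin m → Fin n) → ℤ) → ℤ
∑ᴹ m n g = ∑[ i < n ℕ.^ m ] g (finToFun i)

-- Decoding the code of a map returns it only pointwise, so summands have to respect `≗`.
Extensional : ∀ {m n} → ((Fin m → Fin n) → ℤ) → Set
Extensional g = ∀ {f f′} → f ≗ f′ → g f ≡ g f′

funToFin-cong : ∀ {m n} {f f′ : Fin m → Fin n} → f ≗ f′ → funToFin f ≡ funToFin f′
funToFin-cong {zero}  eq = refl
funToFin-cong {suc m} eq = cong₂ combine (eq zero) (funToFin-cong (eq ∘ suc))

∑ᴹ-reindex : ∀ {m m′} n (π : Fin m ↔ Fin m′) g → Extensional g →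
             ∑ᴹ m′ n g ≡ ∑ᴹ m n (λ f → g (f ∘ Inverse.from π))
∑ᴹ-reindex {m} {m′} n π g ext = trans (sum-permute (g ∘ finToFun) relabel)
  (sum-cong-≗ λ i → ext (finToFun-funToFin (finToFun {n} {m} i ∘ from)))
  where
  open Inverse π using (to; from; strictlyInverseˡ; strictlyInverseʳ)
  cancel : ∀ {k l} (u : Fin k → Fin l) (v : Fin l → Fin k) → (∀ x → v (u x) ≡ x) → ∀ i →
           funToFin (finToFun {n} {l} (funToFin (finToFun {n} {k} i ∘ v)) ∘ u) ≡ i
  cancel {k} {l} u v inv i = trans
    (funToFin-cong λ x → trans (finToFun-funToFin (finToFun {n} {k} i ∘ v) (u x)) (cong (finToFun {n} {k} i) (inv x)))
    (funToFin-finToFin {k} {n} i)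
  relabel : Permutation (n ℕ.^ m) (n ℕ.^ m′)
  relabel = permutation (λ i → funToFin (finToFun {n} {m} i ∘ from)) (λ j → funToFin (finToFun {n} {m′} j ∘ to))
    (cancel from to strictlyInverseˡ) (cancel to from strictlyInverseʳ)

-- `glue` is a bijection from pairs of codes to codes of glued maps, and a sum over pairs is a
-- double sum.
∑ᴹ-split : ∀ m m′ n g → Extensional g →
           ∑ᴹ (m ℕ.+ m′) n g ≡ ∑ᴹ m n (λ f → ∑ᴹ m′ n (λ h → g (f ++ h)))
∑ᴹ-split m m′ n g ext = begin
  ∑ᴹ (m ℕ.+ m′) n g
    ≡⟨ sum-permute (g ∘ finToFun) glue ⟩
  ∑[ k < n ℕ.^ m ℕ.* n ℕ.^ m′ ] g (finToFun (funToFin (pair k)))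
    ≡⟨ sum-cong-≗ (λ k → ext (finToFun-funToFin (pair k))) ⟩
  ∑[ k < n ℕ.^ m ℕ.* n ℕ.^ m′ ] g (pair k)
    ≡⟨ sum-combine (n ℕ.^ m) (n ℕ.^ m′) (g ∘ pair) ⟩
  ∑[ i < n ℕ.^ m ] ∑[ j < n ℕ.^ m′ ] g (pair (combine i j))
    ≡⟨ sum-cong-≗ (λ i → sum-cong-≗ λ j → cong (λ (i , j) → g (finToFun {n} {m} i ++ finToFun {n} {m′} j))
         (remQuot-combine {n ℕ.^ m} i j)) ⟩
  ∑ᴹ m n (λ f → ∑ᴹ m′ n (λ h → g (f ++ h))) ∎
  where
  open ≡-Reasoning
  pair : Fin (n ℕ.^ m ℕ.* n ℕ.^ m′) → Fin (m ℕ.+ m′) → Fin n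
  pair k = finToFun {n} {m} (proj₁ (remQuot {n ℕ.^ m} (n ℕ.^ m′) k)) ++
           finToFun {n} {m′} (proj₂ (remQuot {n ℕ.^ m} (n ℕ.^ m′) k))
  unpair : Fin (n ℕ.^ (m ℕ.+ m′)) → Fin (n ℕ.^ m ℕ.* n ℕ.^ m′)
  unpair l = combine (funToFin (finToFun {n} {m ℕ.+ m′} l ∘ (_↑ˡ m′)))
                     (funToFin (finToFun {n} {m ℕ.+ m′} l ∘ (m ↑ʳ_)))
  restrict-join : ∀ (f : Fin (m ℕ.+ m′) → Fin n) → (f ∘ (_↑ˡ m′)) ++ (f ∘ (m ↑ʳ_)) ≗ f
  restrict-join f p = trans (lem (splitAt m p)) (cong f (join-splitAt m m′ p))
    where
    lem : ∀ u → [ f ∘ (_↑ˡ m′) , f ∘ (m ↑ʳ_) ]′ u ≡ f (join m m′ u)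
    lem (inj₁ _) = refl
    lem (inj₂ _) = refl
  ++-cong : ∀ {f f′ : Fin m → Fin n} {h h′ : Fin m′ → Fin n} → f ≗ f′ → h ≗ h′ → f ++ h ≗ f′ ++ h′
  ++-cong p q x with splitAt m x
  ... | inj₁ y = p y
  ... | inj₂ y = q y
  glue : Permutation (n ℕ.^ m ℕ.* n ℕ.^ m′) (n ℕ.^ (m ℕ.+ m′))
  glue = permutation (funToFin ∘ pair) unpair left right
    where
    left : ∀ l → funToFin (pair (unpair l)) ≡ l
    left l = trans (funToFin-cong λ p → trans
        (cong (λ (i , j) → (finToFun {n} {m} i ++ finToFun {n} {m′} j) p) (remQuot-combine {n ℕ.^ m} _ _))
        (trans (++-cong (finToFun-funToFin _) (finToFun-funToFin _) p) (restrict-join (finToFun {n} {m ℕ.+ m′} l) p)))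
      (funToFin-finToFin {m ℕ.+ m′} {n} l)
    right : ∀ k → unpair (funToFin (pair k)) ≡ k
    right k = trans (cong₂ combine
        (trans (funToFin-cong λ x → trans (finToFun-funToFin (pair k) (x ↑ˡ m′)) (cong [ _ , _ ]′ (splitAt-↑ˡ m x m′)))
               (funToFin-finToFin {m} {n} _))
        (trans (funToFin-cong λ x → trans (finToFun-funToFin (pair k) (m ↑ʳ x)) (cong [ _ , _ ]′ (splitAt-↑ʳ m m′ x)))
               (funToFin-finToFin {m′} {n} _)))
      (combine-remQuot {n ℕ.^ m} (n ℕ.^ m′) k)

-- Maps with values in an interval

Within : ∀ {m n} → ℕ → ℕ → (Fin m → Fin n) → Set
Within c k f = ∀ p → c ℕ.≤ toℕ (f p) × toℕ (f p) ℕ.< c ℕ.+ k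

within? : ∀ {m n} c k (f : Fin m → Fin n) → Dec (Within c k f)
within? c k f = all? λ p → (c ℕ.≤? toℕ (f p)) ×-dec (toℕ (f p) ℕ.<? c ℕ.+ k)

module _ {c k n} (c+k≤n : c ℕ.+ k ℕ.≤ n) where

  translate : Fin k → Fin n
  translate w = fromℕ< (ℕ.<-≤-trans (ℕ.+-monoʳ-< c (toℕ<n w)) c+k≤n)

  toℕ-translate : ∀ w → toℕ (translate w) ≡ c ℕ.+ toℕ w
  toℕ-translate w = toℕ-fromℕ< _

  translate-injective : ∀ {v w} → translate v ≡ translate w → v ≡ w
  translate-injective {v} {w} eq = toℕ-injective (ℕ.+-cancelˡ-≡ c _ _
    (trans (sym (toℕ-translate v)) (trans (cong toℕ eq) (toℕ-translate w))))

  translate-surjective : ∀ v → c ℕ.≤ toℕ v → toℕ v ℕ.< c ℕ.+ k → ∃ λ w → translate w ≡ v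
  translate-surjective v c≤v v<c+k = fromℕ< v∸c<k , toℕ-injective (begin
    toℕ (translate (fromℕ< v∸c<k))    ≡⟨ toℕ-translate (fromℕ< v∸c<k) ⟩
    c ℕ.+ toℕ (fromℕ< v∸c<k)          ≡⟨ cong (c ℕ.+_) (toℕ-fromℕ< v∸c<k) ⟩
    c ℕ.+ (toℕ v ∸ c)                 ≡⟨ ℕ.m+[n∸m]≡n c≤v ⟩
    toℕ v                             ∎)
    where
    open ≡-Reasoning
    v∸c<k : toℕ v ∸ c ℕ.< k
    v∸c<k = ℕ.+-cancelˡ-< c _ _ (subst (ℕ._< c ℕ.+ k) (sym (ℕ.m+[n∸m]≡n c≤v)) v<c+k)

  ∑ᴹ-within : ∀ m g → Extensional g →
              ∑ᴹ m n (λ f → 𝟙 (within? c k f) * g f) ≡ ∑ᴹ m k (λ f → g (translate ∘ f))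
  ∑ᴹ-within m g ext = trans
    (sum-image E E-injective (λ i → within? c k (finToFun {n} {m} i)) sound complete (g ∘ finToFun))
    (sum-cong-≗ λ j → ext (finToFun-funToFin (translate ∘ finToFun {k} {m} j)))
    where
    E : Fin (k ℕ.^ m) → Fin (n ℕ.^ m)
    E j = funToFin (translate ∘ finToFun {k} {m} j)
    finToFun-E : ∀ j → finToFun (E j) ≗ translate ∘ finToFun {k} {m} j
    finToFun-E j = finToFun-funToFin (translate ∘ finToFun {k} {m} j)
    E-injective : ∀ {i j} → E i ≡ E j → i ≡ j
    E-injective {i} {j} eq = trans (sym (funToFin-finToFin {m} {k} i)) (trans
      (funToFin-cong λ p → translate-injective (trans (sym (finToFun-E i p))
        (trans (cong (λ l → finToFun {n} {m} l p) eq) (finToFun-E j p))))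
      (funToFin-finToFin {m} {k} j))
    sound : ∀ j → Within c k (finToFun {n} {m} (E j))
    sound j p rewrite finToFun-E j p | toℕ-translate (finToFun {k} {m} j p) =
      ℕ.m≤m+n c _ , ℕ.+-monoʳ-< c (toℕ<n (finToFun {k} {m} j p))
    complete : ∀ i → Within c k (finToFun {n} {m} i) → ∃ λ j → E j ≡ i
    complete i w = funToFin f , trans
      (funToFin-cong λ p → trans (cong translate (finToFun-funToFin f p)) (proj₂ (preimage p)))
      (funToFin-finToFin {m} {n} i)
      where
      preimage : ∀ p → ∃ λ v → translate v ≡ finToFun {n} {m} i p
      preimage p = translate-surjective _ (proj₁ (w p)) (proj₂ (w p))
      f : Fin m → Fin k
      f p = proj₁ (preimage p)

-- Counting strict maps

𝟙strict : ∀ P {n} → (Fin (size P) → Fin n) → ℤ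
𝟙strict P {n} f = 𝟙 (isStrictMap? P n f)

𝟙strict-extensional : ∀ P {n} → Extensional (𝟙strict P {n})
𝟙strict-extensional P {n} {f} {f′} eq = 𝟙-cong (isStrictMap? P n f) (isStrictMap? P n f′)
  (λ s i j i<j → subst₂ Fin._<_ (eq i) (eq j) (s i j i<j))
  (λ s i j i<j → subst₂ Fin._<_ (sym (eq i)) (sym (eq j)) (s i j i<j))

Ω°-series : FinPoset → Series
Ω°-series P n = + Ω° P n

Ω°-sum : ∀ P n → Ω°-series P n ≡ ∑ᴹ (size P) n (𝟙strict P)
Ω°-sum P n = length-filter-tabulate (isStrictMap? P n ∘ finToFun) id

Ω°-≈ₒ : ∀ P Q → P ≈ₒ Q → Ω°-series P ≗ Ω°-series Q
Ω°-≈ₒ P Q θ n = begin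
  Ω°-series P n                              ≡⟨ Ω°-sum P n ⟩
  ∑ᴹ (size P) n (𝟙strict P)                  ≡⟨ sum-cong-≗ (λ i → pull (finToFun i)) ⟩
  ∑ᴹ (size P) n (λ f → 𝟙strict Q (f ∘ from)) ≡⟨ ∑ᴹ-reindex n bijection (𝟙strict Q) (𝟙strict-extensional Q) ⟨
  ∑ᴹ (size Q) n (𝟙strict Q)                  ≡⟨ Ω°-sum Q n ⟨
  Ω°-series Q n                              ∎
  where
  open ≡-Reasoning
  open _≃_ θ
  pull : ∀ f → 𝟙strict P f ≡ 𝟙strict Q (f ∘ from)
  pull f = 𝟙-cong (isStrictMap? P n f) (isStrictMap? Q n (f ∘ from))
    (λ s i j i<j → s (from i) (from j) (_≃_.mono (≃-sym θ) i<j))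
    (λ s i j i<j → subst₂ (λ x y → f x Fin.< f y) (strictlyInverseʳ i) (strictlyInverseʳ j)
                     (s (to i) (to j) (mono i<j)))

Ω°-⊔ : ∀ P Q → Ω°-series (P ⊔ Q) ≗ Ω°-series P ⊙ Ω°-series Q
Ω°-⊔ P Q n = begin
  Ω°-series (P ⊔ Q) n
    ≡⟨ Ω°-sum (P ⊔ Q) n ⟩
  ∑ᴹ (size (P ⊔ Q)) n (𝟙strict (P ⊔ Q))
    ≡⟨ ∑ᴹ-split (size P) (size Q) n (𝟙strict (P ⊔ Q)) (𝟙strict-extensional (P ⊔ Q)) ⟩
  ∑ᴹ (size P) n (λ f → ∑ᴹ (size Q) n (λ h → 𝟙strict (P ⊔ Q) (f ++ h)))
    ≡⟨ sum-cong-≗ (λ i → sum-cong-≗ λ j → factor (finToFun i) (finToFun j)) ⟩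
  ∑ᴹ (size P) n (λ f → ∑ᴹ (size Q) n (λ h → 𝟙strict P f * 𝟙strict Q h))
    ≡⟨ sum-* (𝟙strict P ∘ finToFun) (𝟙strict Q ∘ finToFun) ⟩
  ∑ᴹ (size P) n (𝟙strict P) * ∑ᴹ (size Q) n (𝟙strict Q)
    ≡⟨ cong₂ _*_ (Ω°-sum P n) (Ω°-sum Q n) ⟨
  Ω°-series P n * Ω°-series Q n ∎
  where
  open ≡-Reasoning
  open _≃_ (⊔-<-≃ P Q)
  factor : ∀ f h → 𝟙strict (P ⊔ Q) (f ++ h) ≡ 𝟙strict P f * 𝟙strict Q h
  factor f h = trans
    (𝟙-cong (isStrictMap? (P ⊔ Q) n (f ++ h)) (isStrictMap? P n f ×-dec isStrictMap? Q n h) forth back)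
    (𝟙-× (isStrictMap? P n f) (isStrictMap? Q n h))
    where
    on-sum : IsStrictMap (P ⊔ Q) n (f ++ h) → ∀ u v → Pointwise (FinPoset._<_ P) (FinPoset._<_ Q) u v →
             [ f , h ]′ u Fin.< [ f , h ]′ v
    on-sum s u v u<v = subst₂ (λ x y → [ f , h ]′ x Fin.< [ f , h ]′ y) (strictlyInverseˡ u) (strictlyInverseˡ v)
      (s (from u) (from v) (_≃_.mono (≃-sym (⊔-<-≃ P Q)) u<v))
    forth : IsStrictMap (P ⊔ Q) n (f ++ h) → IsStrictMap P n f × IsStrictMap Q n h
    forth s = (λ i j i<j → on-sum s (inj₁ i) (inj₁ j) (inj₁ i<j)) ,
              (λ i j i<j → on-sum s (inj₂ i) (inj₂ j) (inj₂ i<j))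
    back : IsStrictMap P n f × IsStrictMap Q n h → IsStrictMap (P ⊔ Q) n (f ++ h)
    back (s , t) i j i<j = go (mono i<j)
      where
      go : ∀ {u v} → Pointwise (FinPoset._<_ P) (FinPoset._<_ Q) u v → [ f , h ]′ u Fin.< [ f , h ]′ v
      go (inj₁ x<y) = s _ _ x<y
      go (inj₂ x<y) = t _ _ x<y

maximum-position : ∀ {m n} → Fin m → (f : Fin m → Fin n) → ∃ λ p → ∀ q → f q Fin.≤ f p
maximum-position {suc zero}    _ f = zero , λ { zero → ℕ.≤-refl }
maximum-position {suc (suc m)} _ f with p , max ← maximum-position {suc m} zero (f ∘ suc)
  with ℕ.≤-total (toℕ (f zero)) (toℕ (f (suc p)))
... | inj₁ f0≤fp = suc p , λ { zero → f0≤fp ; (suc q) → max q }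
... | inj₂ fp≤f0 = zero , λ { zero → ℕ.≤-refl ; (suc q) → ℕ.≤-trans (max q) fp≤f0 }

-- All values of `f` lie below k exactly when its maximum `f p` does, so raising the bound from a to
-- a+1 changes the indicator only for a = `f p`.
𝟙-within-jump : ∀ {m n} (p : Fin m) (f : Fin m → Fin n) → (∀ q → f q Fin.≤ f p) → ∀ a →
                𝟙 (within? 0 (suc (toℕ a)) f) - 𝟙 (within? 0 (toℕ a) f) ≡ 𝟙 (f p ≟ a)
𝟙-within-jump {n = n} p f max a
  rewrite 𝟙-cong (within? 0 (suc (toℕ a)) f) (toℕ (f p) ℕ.<? suc (toℕ a)) (λ w → proj₂ (w p))
            (λ fp<a q → ℕ.z≤n , ℕ.≤-<-trans (max q) fp<a)
        | 𝟙-cong (within? 0 (toℕ a) f) (toℕ (f p) ℕ.<? toℕ a) (λ w → proj₂ (w p))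
            (λ fp<a q → ℕ.z≤n , ℕ.≤-<-trans (max q) fp<a)
  with ℕ.<-cmp (toℕ (f p)) (toℕ a)
... | tri< fp<a fp≢a _ = trans
  (cong₂ _-_ (𝟙-yes (toℕ (f p) ℕ.<? suc (toℕ a)) (ℕ.m<n⇒m<1+n fp<a)) (𝟙-yes (toℕ (f p) ℕ.<? toℕ a) fp<a))
  (sym (𝟙-no (f p ≟ a) (fp≢a ∘ cong toℕ)))
... | tri≈ fp≮a fp≡a _ = trans
  (cong₂ _-_ (𝟙-yes (toℕ (f p) ℕ.<? suc (toℕ a)) (ℕ.≤-reflexive (cong suc fp≡a))) (𝟙-no (toℕ (f p) ℕ.<? toℕ a) fp≮a))
  (sym (𝟙-yes (f p ≟ a) (toℕ-injective fp≡a)))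
... | tri> fp≮a fp≢a a<fp = trans
  (cong₂ _-_ (𝟙-no (toℕ (f p) ℕ.<? suc (toℕ a)) (λ fp<1+a → ℕ.<⇒≱ a<fp (ℕ.s≤s⁻¹ fp<1+a)))
             (𝟙-no (toℕ (f p) ℕ.<? toℕ a) fp≮a))
  (sym (𝟙-no (f p ≟ a) (fp≢a ∘ cong toℕ)))

Below : ∀ {m m′ n} → (Fin m → Fin n) → (Fin m′ → Fin n) → Set
Below f h = ∀ p q → f p Fin.< h q

below? : ∀ {m m′ n} (f : Fin m → Fin n) (h : Fin m′ → Fin n) → Dec (Below f h)
below? f h = all? λ p → all? λ q → f p Fin.<? h q

-- The sum has a single nonzero term, at the maximum a of f.
𝟙-below : ∀ {m m′ n} → Fin m → (f : Fin m → Fin (suc n)) (h : Fin m′ → Fin (suc n)) →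
  𝟙 (below? f h) ≡ ∑[ a < suc n ] ((𝟙 (within? 0 (suc (toℕ a)) f) - 𝟙 (within? 0 (toℕ a) f)) *
                                   𝟙 (within? (suc (toℕ a)) (n ∸ toℕ a) h))
𝟙-below {n = n} p₀ f h with p , max ← maximum-position p₀ f = sym (begin
  ∑[ a < suc n ] ((𝟙 (within? 0 (suc (toℕ a)) f) - 𝟙 (within? 0 (toℕ a) f)) * B a)
    ≡⟨ sum-cong-≗ (λ a → cong (_* B a) (𝟙-within-jump p f max a)) ⟩
  ∑[ a < suc n ] (𝟙 (f p ≟ a) * B a)
    ≡⟨ sum-delta (f p) B ⟩
  B (f p)
    -- The interval starts just above the maximum and ends at `suc n`, so its upper bound holds for
    -- every map and its lower bound says that `h` lies above `f`.
    ≡⟨ 𝟙-cong (within? (suc (toℕ (f p))) (n ∸ toℕ (f p)) h) (below? f h)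
         (λ w p′ q → ℕ.≤-<-trans (max p′) (proj₁ (w q)))
         (λ b q → b p q , subst (λ k → toℕ (h q) ℕ.< suc k) (sym (ℕ.m+[n∸m]≡n (ℕ.s≤s⁻¹ (toℕ<n (f p))))) (toℕ<n (h q))) ⟩
  𝟙 (below? f h) ∎)
  where
  open ≡-Reasoning
  B : Fin (suc n) → ℤ
  B a = 𝟙 (within? (suc (toℕ a)) (n ∸ toℕ a) h)

-- Translation preserves and reflects strictness, so the count depends only on the length of the
-- interval.
∑ᴹ-strict-within : ∀ P c k {n} → c ℕ.+ k ℕ.≤ n →
  ∑ᴹ (size P) n (λ f → 𝟙 (within? c k f) * 𝟙strict P f) ≡ Ω°-series P k
∑ᴹ-strict-within P c k {n} c+k≤n = trans
  (∑ᴹ-within c+k≤n (size P) (𝟙strict P) (𝟙strict-extensional P))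
  (trans (sum-cong-≗ λ i → shift (finToFun i)) (sym (Ω°-sum P k)))
  where
  shift : ∀ f → 𝟙strict P (translate c+k≤n ∘ f) ≡ 𝟙strict P f
  shift f = 𝟙-cong (isStrictMap? P n (translate c+k≤n ∘ f)) (isStrictMap? P k f)
    (λ s i j i<j → ℕ.+-cancelˡ-< c _ _
      (subst₂ ℕ._<_ (toℕ-translate c+k≤n (f i)) (toℕ-translate c+k≤n (f j)) (s i j i<j)))
    (λ s i j i<j → subst₂ ℕ._<_ (sym (toℕ-translate c+k≤n (f i))) (sym (toℕ-translate c+k≤n (f j)))
      (ℕ.+-monoʳ-< c (s i j i<j)))

sum-difference : ∀ {n} (u v w : Fin n → ℤ) →
  ∑[ i < n ] ((u i - v i) * w i) ≡ ∑[ i < n ] (u i * w i) - ∑[ i < n ] (v i * w i)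
sum-difference {zero}  u v w = refl
sum-difference {suc n} u v w = trans
  (cong (λ z → (u zero - v zero) * w zero + z) (sum-difference (u ∘ suc) (v ∘ suc) (w ∘ suc)))
  (lem (u zero) (v zero) (w zero) _ _)
  where
  lem : ∀ u v w s t → (u - v) * w + (s - t) ≡ (u * w + s) - (v * w + t)
  lem = solve-∀

-- The condition that `f` lies below `h` couples the two maps. `𝟙-below` rewrites it as a sum over
-- `a` of products of a factor in `f` and a factor in `h`, so for each `a` the double sum factors.
Ω°-⊕-suc : ∀ P Q → Fin (size P) → ∀ n → Ω°-series (P ⊕ Q) (suc n) ≡
  ∑[ a < suc n ] ((Ω°-series P (suc (toℕ a)) - Ω°-series P (toℕ a)) * Ω°-series Q (n ∸ toℕ a))
Ω°-⊕-suc P Q p₀ n = begin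
  Ω°-series (P ⊕ Q) N
    ≡⟨ Ω°-sum (P ⊕ Q) N ⟩
  ∑ᴹ (size (P ⊕ Q)) N (𝟙strict (P ⊕ Q))
    ≡⟨ ∑ᴹ-split (size P) (size Q) N (𝟙strict (P ⊕ Q)) (𝟙strict-extensional (P ⊕ Q)) ⟩
  ∑ᴹ (size P) N (λ f → ∑ᴹ (size Q) N (λ h → 𝟙strict (P ⊕ Q) (f ++ h)))
    ≡⟨ sum-cong-≗ (λ i → sum-cong-≗ λ j → expand (finToFun i) (finToFun j)) ⟩
  ∑ᴹ (size P) N (λ f → ∑ᴹ (size Q) N (λ h → ∑[ a < N ] (D a f * B a h)))
    ≡⟨ sum-cong-≗ (λ i → ∑-comm (λ j a → D a (finToFun i) * B a (finToFun j))) ⟩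
  ∑ᴹ (size P) N (λ f → ∑[ a < N ] ∑ᴹ (size Q) N (λ h → D a f * B a h))
    ≡⟨ ∑-comm (λ i a → ∑ᴹ (size Q) N (λ h → D a (finToFun i) * B a h)) ⟩
  ∑[ a < N ] ∑ᴹ (size P) N (λ f → ∑ᴹ (size Q) N (λ h → D a f * B a h))
    ≡⟨ sum-cong-≗ (λ a → sum-* (D a ∘ finToFun) (B a ∘ finToFun)) ⟩
  ∑[ a < N ] (∑ᴹ (size P) N (D a) * ∑ᴹ (size Q) N (B a))
    ≡⟨ sum-cong-≗ (λ a → cong₂ _*_ (∑D a)
         (∑ᴹ-strict-within Q (suc (toℕ a)) (n ∸ toℕ a) (ℕ.≤-reflexive (cong suc (ℕ.m+[n∸m]≡n (ℕ.s≤s⁻¹ (toℕ<n a))))))) ⟩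
  ∑[ a < N ] ((Ω°-series P (suc (toℕ a)) - Ω°-series P (toℕ a)) * Ω°-series Q (n ∸ toℕ a)) ∎
  where
  open ≡-Reasoning
  open _≃_ (⊕-<-≃ P Q)
  N = suc n
  _<ₚ_ = FinPoset._<_ P
  _<q_ = FinPoset._<_ Q
  D : Fin N → (Fin (size P) → Fin N) → ℤ
  D a f = (𝟙 (within? 0 (suc (toℕ a)) f) - 𝟙 (within? 0 (toℕ a) f)) * 𝟙strict P f
  B : Fin N → (Fin (size Q) → Fin N) → ℤ
  B a h = 𝟙 (within? (suc (toℕ a)) (n ∸ toℕ a) h) * 𝟙strict Q h
  ∑D : ∀ a → ∑ᴹ (size P) N (D a) ≡ Ω°-series P (suc (toℕ a)) - Ω°-series P (toℕ a)
  ∑D a = trans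
    (sum-difference (λ i → 𝟙 (within? 0 (suc (toℕ a)) (finToFun {N} {size P} i)))
                    (λ i → 𝟙 (within? 0 (toℕ a) (finToFun {N} {size P} i)))
                    (𝟙strict P ∘ finToFun))
    (cong₂ _-_ (∑ᴹ-strict-within P 0 (suc (toℕ a)) {N} (toℕ<n a)) (∑ᴹ-strict-within P 0 (toℕ a) {N} (ℕ.<⇒≤ (toℕ<n a))))
  factor : ∀ f h → 𝟙strict (P ⊕ Q) (f ++ h) ≡ 𝟙 (below? f h) * (𝟙strict P f * 𝟙strict Q h)
  factor f h = trans
    (𝟙-cong (isStrictMap? (P ⊕ Q) N (f ++ h)) (below? f h ×-dec (isStrictMap? P N f ×-dec isStrictMap? Q N h)) forth back)
    (trans (𝟙-× (below? f h) (isStrictMap? P N f ×-dec isStrictMap? Q N h))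
      (cong (𝟙 (below? f h) *_) (𝟙-× (isStrictMap? P N f) (isStrictMap? Q N h))))
    where
    on-sum : IsStrictMap (P ⊕ Q) N (f ++ h) → ∀ u v → (_<ₚ_ ⊎-< _<q_) u v → [ f , h ]′ u Fin.< [ f , h ]′ v
    on-sum s u v u<v = subst₂ (λ x y → [ f , h ]′ x Fin.< [ f , h ]′ y) (strictlyInverseˡ u) (strictlyInverseˡ v)
      (s (from u) (from v) (_≃_.mono (≃-sym (⊕-<-≃ P Q)) u<v))
    forth : IsStrictMap (P ⊕ Q) N (f ++ h) → Below f h × (IsStrictMap P N f × IsStrictMap Q N h)
    forth s = (λ i j → on-sum s (inj₁ i) (inj₂ j) ₁∼₂) ,
              (λ i j i<j → on-sum s (inj₁ i) (inj₁ j) (₁∼₁ i<j)) ,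
              (λ i j i<j → on-sum s (inj₂ i) (inj₂ j) (₂∼₂ i<j))
    back : Below f h × (IsStrictMap P N f × IsStrictMap Q N h) → IsStrictMap (P ⊕ Q) N (f ++ h)
    back (b , s , t) i j i<j = go (mono i<j)
      where
      go : ∀ {u v} → (_<ₚ_ ⊎-< _<q_) u v → [ f , h ]′ u Fin.< [ f , h ]′ v
      go ₁∼₂       = b _ _
      go (₁∼₁ x<y) = s _ _ x<y
      go (₂∼₂ x<y) = t _ _ x<y
  expand : ∀ f h → 𝟙strict (P ⊕ Q) (f ++ h) ≡ ∑[ a < N ] (D a f * B a h)
  expand f h = begin
    𝟙strict (P ⊕ Q) (f ++ h)
      ≡⟨ factor f h ⟩
    𝟙 (below? f h) * (𝟙strict P f * 𝟙strict Q h)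
      ≡⟨ cong (_* (𝟙strict P f * 𝟙strict Q h)) (𝟙-below p₀ f h) ⟩
    ∑[ a < N ] (D′ a * B′ a) * (𝟙strict P f * 𝟙strict Q h)
      ≡⟨ *-distribʳ-sum (𝟙strict P f * 𝟙strict Q h) (λ a → D′ a * B′ a) ⟩
    ∑[ a < N ] ((D′ a * B′ a) * (𝟙strict P f * 𝟙strict Q h))
      ≡⟨ sum-cong-≗ (λ a → lem (D′ a) (B′ a) (𝟙strict P f) (𝟙strict Q h)) ⟩
    ∑[ a < N ] (D a f * B a h) ∎
    where
    D′ B′ : Fin N → ℤ
    D′ a = 𝟙 (within? 0 (suc (toℕ a)) f) - 𝟙 (within? 0 (toℕ a) f)
    B′ a = 𝟙 (within? (suc (toℕ a)) (n ∸ toℕ a) h)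
    lem : ∀ d b s t → (d * b) * (s * t) ≡ (d * s) * (b * t)
    lem = solve-∀

Ω°-zero : ∀ P → Fin (size P) → Ω°-series P 0 ≡ 0ℤ
Ω°-zero P p = trans (Ω°-sum P 0) (sum-zero (λ i → 𝟙strict P (finToFun {0} {size P} i))
  λ i → no-map (finToFun {0} {size P} i p))
  where
  no-map : ∀ {A : Set} → Fin 0 → A
  no-map ()

Ω°-⊕ : ∀ P Q → Fin (size P) → Ω°-series (P ⊕ Q) ≗ Ω°-series P · 1-x · Ω°-series Q
Ω°-⊕ P Q p₀ zero = trans (Ω°-zero (P ⊕ Q) (p₀ ↑ˡ size Q))
  (sym (cong (λ z → (z * 1ℤ + 0ℤ) * Ω°-series Q 0 + 0ℤ) (Ω°-zero P p₀)))
Ω°-⊕ P Q p₀ (suc n) = begin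
  Ω°-series (P ⊕ Q) (suc n)
    ≡⟨ Ω°-⊕-suc P Q p₀ n ⟩
  ((λ a → Ω°-series P (suc a) - Ω°-series P a) · Ω°-series Q) n
    ≡⟨ ·-congʳ (Ω°-series Q) (λ a → trans (sym (1-x·-suc (Ω°-series P) a)) (·-comm 1-x (Ω°-series P) (suc a))) n ⟩
  ((λ a → (Ω°-series P · 1-x) (suc a)) · Ω°-series Q) n
    -- The sum lacks the first term of the convolution, which is zero because a nonempty poset has
    -- no map to the empty chain.
    ≡⟨ ℤ.+-identityˡ _ ⟨
  0ℤ + ((λ a → (Ω°-series P · 1-x) (suc a)) · Ω°-series Q) n
    ≡⟨ cong (λ z → (z * 1ℤ + 0ℤ) * Ω°-series Q (suc n) +
                ((λ a → (Ω°-series P · 1-x) (suc a)) · Ω°-series Q) n) (Ω°-zero P p₀) ⟨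
  (Ω°-series P · 1-x · Ω°-series Q) (suc n) ∎
  where open ≡-Reasoning

Ω°-∅ : ∀ P → ∅ ≈ₒ P → ∀ n → Ω°-series P n ≡ 1ℤ
Ω°-∅ P e n = sym (Ω°-≈ₒ ∅ P e n)

Ω°-pt : ∀ n → Ω°-series pt n ≡ + n
Ω°-pt n = trans (Ω°-sum pt n) (trans
  (sum-one (λ i → 𝟙strict pt (finToFun {n} {1} i)) λ i →
    𝟙-yes (isStrictMap? pt n (finToFun {n} {1} i)) λ { zero zero (_ , 0≢0) → ⊥-elim (0≢0 refl) })
  (cong +_ (ℕ.^-identityʳ n)))

-- Coefficients in the binomial basis

combination-tabulate : ∀ {k} b (c : Fin k → ℤ) n →
                       combination b (tabulate c) n ≡ ∑[ i < k ] (c i * b (toℕ i) n)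
combination-tabulate {zero}  b c n = refl
combination-tabulate {suc k} b c n =
  cong (λ z → c zero * b 0 n + z) (combination-tabulate (b ∘ suc) (c ∘ suc) n)

-- Mirrors `∑₁`: the index 0 is kept for the empty poset and filled with a zero otherwise.
coefficients : ℕ → (ℕ → ℤ) → List ℤ
coefficients zero    c = c 0 ∷ []
coefficients (suc m) c = 0ℤ ∷ tabulate {n = suc m} (λ i → c (suc (toℕ i)))

∑₁-combination : ∀ m c b n → ∑₁ m (λ i → c i * b i n) ≡ combination b (coefficients m c) n
∑₁-combination zero    c b n = sym (ℤ.+-identityʳ _)
∑₁-combination (suc m) c b n = sym (trans (ℤ.+-identityˡ _)
  (combination-tabulate (b ∘ suc) (λ (i : Fin (suc m)) → c (suc (toℕ i))) n))

∑₁-cong : ∀ m {f g : ℕ → ℤ} → (∀ i → i ℕ.≤ m → f i ≡ g i) → ∑₁ m f ≡ ∑₁ m g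
∑₁-cong zero    eq = eq 0 z≤n
∑₁-cong (suc m) {f} {g} eq = sum-cong-≗ {n = suc m} λ i → eq (suc (toℕ i)) (toℕ<n i)

-- The premise asks for `c 0 ≡ 0ℤ` only when `m` is positive, which is the form in which `Ω°-zero`
-- supplies it.
coefficients-tabulate : ∀ m c → (Fin m → c 0 ≡ 0ℤ) → coefficients m c ≡ tabulate {n = suc m} (c ∘ toℕ)
coefficients-tabulate zero    c c₀ = refl
coefficients-tabulate (suc m) c c₀ = cong (_∷ tabulate {n = suc m} (λ i → c (suc (toℕ i)))) (sym (c₀ zero))

-- Newton's expansion: the coefficients are the iterated differences at 0.

Δ : Series → Series
Δ f n = f (suc n) - f n

differences : Series → ℕ → ℤ
differences f zero    = f 0
differences f (suc i) = differences (Δ f) i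

antidifference : ∀ f cs → combination binomial cs ≗ Δ f → combination binomial (f 0 ∷ cs) ≗ f
antidifference f cs eq zero    = binomial-∷-zero (f 0) cs
antidifference f cs eq (suc n) = begin
  combination binomial (f 0 ∷ cs) (suc n)                       ≡⟨ binomial-∷-suc (f 0) cs n ⟩
  combination binomial (f 0 ∷ cs) n + combination binomial cs n ≡⟨ cong₂ _+_ (antidifference f cs eq n) (eq n) ⟩
  f n + (f (suc n) - f n)                                       ≡⟨ lem (f n) (f (suc n)) ⟩
  f (suc n)                                                     ∎
  where
  open ≡-Reasoning
  lem : ∀ x y → x + (y - x) ≡ y
  lem = solve-∀

-- The list `cs` only certifies that differences of order `k` and above vanish; the coefficients are
-- recomputed from `f`.
newton : ∀ k cs f → length cs ℕ.≤ k → f ≗ combination binomial cs →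
         combination binomial (tabulate {n = k} (differences f ∘ toℕ)) ≗ f
newton zero    []       f _ eq n = sym (eq n)
newton (suc k) []       f _ eq = antidifference f (tabulate {n = k} (differences (Δ f) ∘ toℕ))
  (newton k [] (Δ f) z≤n λ n → cong₂ _-_ (eq (suc n)) (eq n))
newton (suc k) (c ∷ cs) f (s≤s cs≤k) eq = antidifference f (tabulate {n = k} (differences (Δ f) ∘ toℕ))
  (newton k cs (Δ f) cs≤k λ n → begin
    f (suc n) - f n
      ≡⟨ cong₂ _-_ (trans (eq (suc n)) (binomial-∷-suc c cs n)) (eq n) ⟩
    combination binomial (c ∷ cs) n + combination binomial cs n - combination binomial (c ∷ cs) n
      ≡⟨ lem (combination binomial (c ∷ cs) n) (combination binomial cs n) ⟩
    combination binomial cs n ∎)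
  where
  open ≡-Reasoning
  lem : ∀ x y → x + y - x ≡ y
  lem = solve-∀

⊞-length : ∀ {k} cs ds → length cs ℕ.≤ k → length ds ℕ.≤ k → length (cs ⊞ ds) ℕ.≤ k
⊞-length []       ds       p q = q
⊞-length (c ∷ cs) []       p q = p
⊞-length (c ∷ cs) (d ∷ ds) (s≤s p) (s≤s q) = s≤s (⊞-length cs ds p q)

-- A list of length l has degree at most l-1 and degrees add, which accounts for `pred`.
binomial-mul-length : ∀ cs ds → length (binomial-mul cs ds) ℕ.≤ pred (length cs ℕ.+ length ds)
binomial-mul-length []       ds       = z≤n
binomial-mul-length (c ∷ cs) []       = z≤n
binomial-mul-length (c ∷ cs) (d ∷ ds) =
  subst (λ k → length (binomial-mul (c ∷ cs) (d ∷ ds)) ℕ.≤ k) (sym (ℕ.+-suc (length cs) (length ds)))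
  (s≤s (⊞-length (binomial-mul (c ∷ cs) ds) (binomial-mul cs (d ∷ ds) ⊞ binomial-mul cs ds)
    (binomial-mul-length (c ∷ cs) ds)
    (⊞-length (binomial-mul cs (d ∷ ds)) (binomial-mul cs ds)
      (subst (λ k → length (binomial-mul cs (d ∷ ds)) ℕ.≤ pred k) (ℕ.+-suc (length cs) (length ds))
        (binomial-mul-length cs (d ∷ ds)))
      (ℕ.≤-trans (binomial-mul-length cs ds) ℕ.pred[n]≤n))))

conv-length : ∀ m cs ds → length ds ℕ.≤ suc m → length (conv cs ds) ℕ.≤ length cs ℕ.+ m
conv-length m []       ds ds≤ = z≤n
conv-length m (c ∷ cs) ds ds≤ = ⊞-length (scale c ds) (0ℤ ∷ conv cs ds)
  (ℕ.≤-trans (ℕ.≤-reflexive (length-map (c *_) ds)) (ℕ.≤-trans ds≤ (s≤s (ℕ.m≤n+m m (length cs)))))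
  (s≤s (conv-length m cs ds ds≤))

-- Existence of the coefficients

Representable : ℕ → Series → Set
Representable m f = Σ[ cs ∈ List ℤ ] (length cs ℕ.≤ suc m × f ≗ combination binomial cs)

Ω°-series-∅ : ∀ P → ∅ ≈ₒ P → Ω°-series P ≗ combination binomial (1ℤ ∷ [])
Ω°-series-∅ P e n = trans (Ω°-∅ P e n) (cong (λ k → 1ℤ * + k + 0ℤ) (sym (nC0≡1 n)))

Ω°-series-pt : Ω°-series pt ≗ combination binomial (0ℤ ∷ 1ℤ ∷ [])
Ω°-series-pt n = begin
  Ω°-series pt n                                  ≡⟨ Ω°-pt n ⟩
  + n                                             ≡⟨ cong +_ (nC1≡n n) ⟨
  + (n C 1)                                       ≡⟨ lem (+ (n C 0)) (+ (n C 1)) ⟩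
  combination binomial (0ℤ ∷ 1ℤ ∷ []) n           ∎
  where
  open ≡-Reasoning
  lem : ∀ x y → y ≡ 0ℤ * x + (1ℤ * y + 0ℤ)
  lem = solve-∀

element : ∀ {X} (t : Expr X) → Fin (size ⟦ t ⟧)
element (leaf x) = zero
element (s ⊔ᵉ t) = element s ↑ˡ size ⟦ t ⟧
element (s ⊕ᵉ t) = element s ↑ˡ size ⟦ t ⟧

Ω°-representable : ∀ {X} (t : Expr X) → Representable (size ⟦ t ⟧) (Ω°-series ⟦ t ⟧)
Ω°-representable (leaf x) = 0ℤ ∷ 1ℤ ∷ [] , ℕ.≤-refl , Ω°-series-pt
Ω°-representable (s ⊔ᵉ t) with cs , cs≤ , cs≗ ← Ω°-representable s | ds , ds≤ , ds≗ ← Ω°-representable t =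
  binomial-mul cs ds ,
  ℕ.≤-trans (binomial-mul-length cs ds)
    (ℕ.≤-trans (ℕ.pred-mono-≤ (ℕ.+-mono-≤ cs≤ ds≤)) (ℕ.≤-reflexive (ℕ.+-suc (size ⟦ s ⟧) (size ⟦ t ⟧)))) ,
  λ n → trans (Ω°-⊔ ⟦ s ⟧ ⟦ t ⟧ n) (trans (cong₂ _*_ (cs≗ n) (ds≗ n)) (sym (binomial-mul-correct cs ds n)))
Ω°-representable (s ⊕ᵉ t) with cs , cs≤ , cs≗ ← Ω°-representable s | ds , ds≤ , ds≗ ← Ω°-representable t =
  conv cs ds ,
  ℕ.≤-trans (conv-length (size ⟦ t ⟧) cs ds ds≤) (ℕ.+-monoˡ-≤ (size ⟦ t ⟧) cs≤) ,
  λ n → trans (Ω°-⊕ ⟦ s ⟧ ⟦ t ⟧ (element s) n)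
    (trans (·-cong {Ω°-series ⟦ s ⟧ · 1-x} {combination binomial cs · 1-x} {Ω°-series ⟦ t ⟧} {combination binomial ds}
             (·-congʳ 1-x cs≗) ds≗ n)
           (sym (geometric-conv binomial-geometric cs ds n)))

size-≈ₒ : ∀ P Q → P ≈ₒ Q → size P ≡ size Q
size-≈ₒ P Q θ = ↔⇒≡ (_≃_.bijection θ)

Ω°-representable-IsSP∅ : ∀ P → IsSP∅ P → Representable (size P) (Ω°-series P)
Ω°-representable-IsSP∅ P (inj₂ e) = 1ℤ ∷ [] , s≤s z≤n , Ω°-series-∅ P (≅⇒≈ₒ ∅ P e)
Ω°-representable-IsSP∅ P (inj₁ (t , t≅P)) with cs , cs≤ , cs≗ ← Ω°-representable t =
  cs , subst (λ k → length cs ℕ.≤ suc k) (size-≈ₒ ⟦ t ⟧ P (≅⇒≈ₒ ⟦ t ⟧ P t≅P)) cs≤ ,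
  λ n → trans (sym (Ω°-≈ₒ ⟦ t ⟧ P (≅⇒≈ₒ ⟦ t ⟧ P t≅P) n)) (cs≗ n)

-- Iterated differences exist for every poset, so this depends on no chosen expression and on no
-- proof of `IsSP∅`.
strict-coefficients : FinPoset → ℕ → ℤ
strict-coefficients P = differences (Ω°-series P)

strict-coefficients-correct : IsStrictCoefficients strict-coefficients
strict-coefficients-correct P sp n with cs , cs≤ , cs≗ ← Ω°-representable-IsSP∅ P sp = sym (begin
  ∑₁ (size P) (λ i → strict-coefficients P i * + (n C i))
    ≡⟨ ∑₁-combination (size P) (strict-coefficients P) binomial n ⟩
  combination binomial (coefficients (size P) (strict-coefficients P)) n
    ≡⟨ cong (λ cs → combination binomial cs n) (coefficients-tabulate (size P) (strict-coefficients P) (Ω°-zero P)) ⟩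
  combination binomial (tabulate {n = suc (size P)} (strict-coefficients P ∘ toℕ)) n
    ≡⟨ newton (suc (size P)) cs (Ω°-series P) cs≤ cs≗ n ⟩
  Ω°-series P n ∎)
  where open ≡-Reasoning

Ω°-⊕-IsSP∅ : ∀ P Q → IsSP∅ P → Ω°-series (P ⊕ Q) ≗ Ω°-series P · 1-x · Ω°-series Q
Ω°-⊕-IsSP∅ P Q (inj₁ (t , φ , _)) = Ω°-⊕ P Q (φ (element t))
Ω°-⊕-IsSP∅ P Q (inj₂ ∅≅P) n = begin
  Ω°-series (P ⊕ Q) n                            ≡⟨ Ω°-≈ₒ (P ⊕ Q) Q (⊕-emptyˡ P e Q) n ⟩
  Ω°-series Q n                                  ≡⟨ 1/[1-x]·1-x· (Ω°-series Q) n ⟨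
  (1/[1-x] · 1-x · Ω°-series Q) n                ≡⟨ ·-congʳ (Ω°-series Q) (·-congʳ 1-x (Ω°-∅ P e)) n ⟨
  (Ω°-series P · 1-x · Ω°-series Q) n            ∎
  where
  open ≡-Reasoning
  e = ≅⇒≈ₒ ∅ P ∅≅P

pt-IsSP∅ : IsSP∅ pt
pt-IsSP∅ = inj₁ (leaf _ , ≈ₒ⇒≅ pt pt ≃-refl)

∅-IsSP∅ : IsSP∅ ∅
∅-IsSP∅ = inj₂ (≈ₒ⇒≅ ∅ ∅ ≃-refl)

-- The shuffle series

-- Forward, this is well-definedness of `ψ`, which acts on stored lists, and rests on independence
-- of its source basis; backward, it is injectivity and rests on independence of its target basis.
ψ-injective : (f g : Span 1/[1-x]^1+) → (series f ≗ series g) ⇔ (series (ψ f) ≗ series (ψ g))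
ψ-injective f g = mk⇔
  (λ eq → change-of-basis 1/[1-x]^1+-independent (coeffs f) (coeffs g)
    (λ n → trans (sym (expansion f n)) (trans (eq n) (expansion g n))) [1-x]^-1+)
  (λ eq n → trans (expansion f n) (trans
    (change-of-basis [1-x]^-1+-independent (coeffs f) (coeffs g) eq 1/[1-x]^1+ n) (sym (expansion g n))))

-- Separates a global sign from a sign that belongs to the basis element, using that (-1)^i is its
-- own inverse.
sign-∸ : ∀ {i m} → i ℕ.≤ m → -1ℤ ℤ.^ (m ∸ i) ≡ -1ℤ ℤ.^ m * -1ℤ ℤ.^ i
sign-∸ {m = m} z≤n = sym (ℤ.*-identityʳ (-1ℤ ℤ.^ m))
sign-∸ (s≤s {i} {m} i≤m) = trans (sign-∸ i≤m) (lem (-1ℤ ℤ.^ m) (-1ℤ ℤ.^ i))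
  where
  lem : ∀ x y → x * y ≡ (-1ℤ * x) * (-1ℤ * y)
  lem = solve-∀

module Expansion (d : FinPoset → ℕ → ℤ) (correct : IsStrictCoefficients d) where

  expand : (ℕ → Series) → FinPoset → Series
  expand b P = combination b (coefficients (size P) (d P))

  Ω°-expand : ∀ P → IsSP∅ P → Ω°-series P ≗ expand binomial P
  Ω°-expand P sp n = trans (correct P sp n) (∑₁-combination (size P) (d P) binomial n)

  -- Identities of Ω° pass to the other bases through this: by independence of the binomials, any
  -- list expanding Ω° may replace `d`.
  expand-unique : ∀ b P → IsSP∅ P → ∀ cs → Ω°-series P ≗ combination binomial cs → expand b P ≗ combination b cs
  expand-unique b P sp cs eq = change-of-basis binomial-independent (coefficients (size P) (d P)) cs
    (λ n → trans (sym (Ω°-expand P sp n)) (eq n)) b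

  expand-≈ₒ : ∀ b P Q → P ≈ₒ Q → IsSP∅ P → expand b P ≗ expand b Q
  expand-≈ₒ b P Q θ sp = expand-unique b P sp (coefficients (size Q) (d Q)) λ n →
    trans (Ω°-≈ₒ P Q θ n) (Ω°-expand Q (IsSP∅-resp P Q θ sp) n)

  -- The list `binomial-mul cs ds` expands a product of polynomials both at n and at -1-n. The first
  -- identifies it with the coefficients of P ⊔ Q, the second gives the Hadamard product.
  expand-⊔ : ∀ P Q → IsSP∅ P → IsSP∅ Q →
             expand negative-binomial (P ⊔ Q) ≗ expand negative-binomial P ⊙ expand negative-binomial Q
  expand-⊔ P Q p q n = trans
    (expand-unique negative-binomial (P ⊔ Q) (⊔-IsSP∅ P Q p q) (binomial-mul cs ds)
      (λ n → trans (Ω°-⊔ P Q n) (trans (cong₂ _*_ (Ω°-expand P p n) (Ω°-expand Q q n))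
                                       (sym (binomial-mul-correct cs ds n)))) n)
    (negative-binomial-mul-correct cs ds n)
    where
    cs = coefficients (size P) (d P)
    ds = coefficients (size Q) (d Q)

  expand-⊕ : ∀ {b} → Geometric b → ∀ P Q → IsSP∅ P → IsSP∅ Q →
             expand b (P ⊕ Q) ≗ expand b P · 1-x · expand b Q
  expand-⊕ {b} G P Q p q n = trans
    (expand-unique b (P ⊕ Q) (⊕-IsSP∅ P Q p q) (conv cs ds)
      (λ n → trans (Ω°-⊕-IsSP∅ P Q p n) (trans
        (·-cong {Ω°-series P · 1-x} {combination binomial cs · 1-x} {Ω°-series Q} {combination binomial ds}
          (·-congʳ 1-x (Ω°-expand P p)) (Ω°-expand Q q) n)
        (sym (geometric-conv binomial-geometric cs ds n)))) n)
    (geometric-conv G cs ds n)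
    where
    cs = coefficients (size P) (d P)
    ds = coefficients (size Q) (d Q)

  -- `SH d` and `ddSH d` are by definition the cases `1/[1-x]^1+` and `[1-x]^-1+` of this.
  signed : (ℕ → Series) → FinPoset → Series
  signed b P n = ∑₁ (size P) λ i → -1ℤ ℤ.^ (size P ∸ i) * d P i * b i n

  signed-coefficients : FinPoset → List ℤ
  signed-coefficients P = coefficients (size P) λ i → -1ℤ ℤ.^ (size P ∸ i) * d P i

  signed-combination : ∀ b P → signed b P ≗ combination b (signed-coefficients P)
  signed-combination b P = ∑₁-combination (size P) (λ i → -1ℤ ℤ.^ (size P ∸ i) * d P i) b

  signed-expand : ∀ b P n → signed b P n ≡ -1ℤ ℤ.^ size P * expand (alternating b) P n
  signed-expand b P n = begin
    signed b P n
      ≡⟨ ∑₁-cong (size P) (λ i i≤m → trans (cong (λ s → s * d P i * b i n) (sign-∸ i≤m))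
           (lem (-1ℤ ℤ.^ size P) (-1ℤ ℤ.^ i) (d P i) (b i n))) ⟩
    ∑₁ (size P) (λ i → d P i * (-1ℤ ℤ.^ size P * alternating b i n))
      ≡⟨ ∑₁-combination (size P) (d P) (λ i n → -1ℤ ℤ.^ size P * alternating b i n) n ⟩
    expand (λ i n → -1ℤ ℤ.^ size P * alternating b i n) P n
      ≡⟨ combination-scale (-1ℤ ℤ.^ size P) {b′ = alternating b} n n (λ _ → refl) (coefficients (size P) (d P)) ⟩
    -1ℤ ℤ.^ size P * expand (alternating b) P n ∎
    where
    open ≡-Reasoning
    lem : ∀ s t d b → s * t * d * b ≡ d * (s * (t * b))
    lem = solve-∀

  signed-≈ₒ : ∀ b P Q → P ≈ₒ Q → IsSP∅ P → signed b P ≗ signed b Q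
  signed-≈ₒ b P Q θ sp n = trans (signed-expand b P n) (trans
    (cong₂ (λ m z → -1ℤ ℤ.^ m * z) (size-≈ₒ P Q θ) (expand-≈ₒ (alternating b) P Q θ sp n))
    (sym (signed-expand b Q n)))

  signed-⊔ : ∀ P Q → IsSP∅ P → IsSP∅ Q →
             signed 1/[1-x]^1+ (P ⊔ Q) ≗ signed 1/[1-x]^1+ P ⊙ signed 1/[1-x]^1+ Q
  signed-⊔ P Q p q n = begin
    signed 1/[1-x]^1+ (P ⊔ Q) n
      ≡⟨ signed-expand 1/[1-x]^1+ (P ⊔ Q) n ⟩
    -1ℤ ℤ.^ (size P ℕ.+ size Q) * expand negative-binomial (P ⊔ Q) n
      ≡⟨ cong₂ _*_ (ℤ.^-distribˡ-+-* -1ℤ (size P) (size Q)) (expand-⊔ P Q p q n) ⟩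
    (-1ℤ ℤ.^ size P * -1ℤ ℤ.^ size Q) * (expand negative-binomial P n * expand negative-binomial Q n)
      ≡⟨ lem (-1ℤ ℤ.^ size P) (-1ℤ ℤ.^ size Q) (expand negative-binomial P n) (expand negative-binomial Q n) ⟩
    (-1ℤ ℤ.^ size P * expand negative-binomial P n) * (-1ℤ ℤ.^ size Q * expand negative-binomial Q n)
      ≡⟨ cong₂ _*_ (signed-expand 1/[1-x]^1+ P n) (signed-expand 1/[1-x]^1+ Q n) ⟨
    signed 1/[1-x]^1+ P n * signed 1/[1-x]^1+ Q n ∎
    where
    open ≡-Reasoning
    lem : ∀ s t x y → (s * t) * (x * y) ≡ (s * x) * (t * y)
    lem = solve-∀

  signed-⊕ : ∀ {b} → Geometric b → ∀ P Q → IsSP∅ P → IsSP∅ Q →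
             signed b (P ⊕ Q) ≗ signed b P · 1-x · signed b Q
  signed-⊕ {b} G P Q p q n = begin
    signed b (P ⊕ Q) n
      ≡⟨ signed-expand b (P ⊕ Q) n ⟩
    -1ℤ ℤ.^ (size P ℕ.+ size Q) * E (P ⊕ Q) n
      ≡⟨ cong₂ _*_ (ℤ.^-distribˡ-+-* -1ℤ (size P) (size Q)) (expand-⊕ (alternating-geometric G) P Q p q n) ⟩
    s * t * (E P · 1-x · E Q) n
      ≡⟨ ℤ.*-assoc s t _ ⟩
    s * (t * (E P · 1-x · E Q) n)
      ≡⟨ cong (s *_) (·-scaleʳ t (E P · 1-x) (E Q) n) ⟨
    s * (E P · 1-x · tQ) n
      ≡⟨ ·-scaleˡ s (E P · 1-x) tQ n ⟨
    ((λ n → s * (E P · 1-x) n) · tQ) n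
      ≡⟨ ·-congʳ tQ (·-scaleˡ s (E P) 1-x) n ⟨
    ((λ n → s * E P n) · 1-x · tQ) n
      ≡⟨ ·-cong {signed b P · 1-x} {(λ n → s * E P n) · 1-x} {signed b Q} {tQ}
           (·-congʳ 1-x (signed-expand b P)) (signed-expand b Q) n ⟨
    (signed b P · 1-x · signed b Q) n ∎
    where
    open ≡-Reasoning
    s t : ℤ
    s = -1ℤ ℤ.^ size P
    t = -1ℤ ℤ.^ size Q
    E : FinPoset → Series
    E = expand (alternating b)
    tQ : Series
    tQ n = t * E Q n

  -- Ω° of the point is binom(n,1), and for i = 1 the global sign cancels that of the basis.
  signed-pt : ∀ b → signed b pt ≗ b 1
  signed-pt b n = trans (signed-expand b pt n) (trans
    (cong (λ z → -1ℤ ℤ.^ 1 * z) (expand-unique (alternating b) pt pt-IsSP∅ (0ℤ ∷ 1ℤ ∷ []) Ω°-series-pt n))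
    (lem (b 0 n) (b 1 n)))
    where
    lem : ∀ x y → -1ℤ * 1ℤ * (0ℤ * (1ℤ * x) + (1ℤ * (-1ℤ * 1ℤ * y) + 0ℤ)) ≡ y
    lem = solve-∀

  signed-∅ : ∀ b → signed b ∅ ≗ b 0
  signed-∅ b n = trans (signed-expand b ∅ n) (trans
    (cong (λ z → -1ℤ ℤ.^ 0 * z) (expand-unique (alternating b) ∅ ∅-IsSP∅ (1ℤ ∷ []) (Ω°-series-∅ ∅ ≃-refl) n))
    (lem (b 0 n)))
    where
    lem : ∀ x → 1ℤ * (1ℤ * (1ℤ * x) + 0ℤ) ≡ x
    lem = solve-∀

  lddSH-basis : ∀ i → 𝐱 ^ suc i · 1/[1-x]^1+ i ≗ 𝐱 · binomial i
  lddSH-basis zero n = trans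
    (·-cong {𝐱 ^ 1} {𝐱} {1/[1-x] ^ 1} {1/[1-x]} (·-identityʳ 𝐱) (·-identityʳ 1/[1-x]) n)
    (·-congˡ 𝐱 (λ m → sym (Geometric.b-zero binomial-geometric m)) n)
  lddSH-basis (suc i) n = begin
    (𝐱 · 𝐱 ^ suc i · (1/[1-x] · 1/[1-x] ^ suc i)) n
      ≡⟨ solve 4 (λ a b c e → (a ⊗ b) ⊗ (c ⊗ e) ⊜ (a ⊗ c) ⊗ (b ⊗ e)) (λ _ → refl)
           𝐱 (𝐱 ^ suc i) 1/[1-x] (1/[1-x] ^ suc i) n ⟩
    (𝐱 · 1/[1-x] · (𝐱 ^ suc i · 1/[1-x] ^ suc i)) n
      ≡⟨ ·-congˡ (𝐱 · 1/[1-x]) (lddSH-basis i) n ⟩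
    (𝐱 · 1/[1-x] · (𝐱 · binomial i)) n
      ≡⟨ solve 3 (λ a c e → (a ⊗ c) ⊗ (a ⊗ e) ⊜ a ⊗ ((a ⊗ c) ⊗ e)) (λ _ → refl) 𝐱 1/[1-x] (binomial i) n ⟩
    (𝐱 · (𝐱 · 1/[1-x] · binomial i)) n
      ≡⟨ ·-congˡ 𝐱 (λ m → sym (Geometric.b-suc binomial-geometric i m)) n ⟩
    (𝐱 · binomial (suc i)) n ∎
    where open ≡-Reasoning

  -- The basis of `lddSH` is x times the binomial generating functions, so `lddSH` is the generating
  -- function of Ω° shifted by one degree.
  lddSH-Ω° : ∀ P → IsSP∅ P → lddSH d P ≗ 𝐱 · Ω°-series P
  lddSH-Ω° P sp n = begin
    lddSH d P n
      ≡⟨ ∑₁-combination (size P) (d P) (λ i → 𝐱 ^ suc i · 1/[1-x]^1+ i) n ⟩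
    expand (λ i → 𝐱 ^ suc i · 1/[1-x]^1+ i) P n
      ≡⟨ combination-cong n n (λ i → lddSH-basis i n) (coefficients (size P) (d P)) ⟩
    expand (λ i → 𝐱 · binomial i) P n
      ≡⟨ ·-combinationʳ binomial (coefficients (size P) (d P)) 𝐱 n ⟨
    (𝐱 · expand binomial P) n
      ≡⟨ ·-congˡ 𝐱 (λ m → sym (Ω°-expand P sp m)) n ⟩
    (𝐱 · Ω°-series P) n ∎
    where open ≡-Reasoning

-- From formulas for a family of series to an algebra over `𝒮𝒫`

module _ {D : Set} (ι : D → Series) (F : FinPoset → Series) {gen unit : Series} (op-⊔ op-⊕ : D → D → Series)
  (contains  : ∀ P → IsSP∅ P → Σ[ f ∈ D ] ι f ≗ F P)
  (F-≈ₒ      : ∀ P Q → P ≈ₒ Q → IsSP∅ P → F P ≗ F Q)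
  (F-⊔       : ∀ P Q → IsSP∅ P → IsSP∅ Q → ∀ f g → ι f ≗ F P → ι g ≗ F Q → F (P ⊔ Q) ≗ op-⊔ f g)
  (F-⊕       : ∀ P Q → IsSP∅ P → IsSP∅ Q → ∀ f g → ι f ≗ F P → ι g ≗ F Q → F (P ⊕ Q) ≗ op-⊕ f g)
  (generator : F pt ≗ gen)
  (unit-∅    : F ∅ ≗ unit) where

  private
    open Setoid (Family ι F) using (Carrier)

    member : ∀ P → IsSP∅ P → Carrier
    member P p = proj₁ (contains P p) , P , p , proj₂ (contains P p)

    index : Carrier → FinPoset
    index f = proj₁ (proj₂ f)

    isSP∅ : ∀ f → IsSP∅ (index f)
    isSP∅ f = proj₁ (proj₂ (proj₂ f))

    value : ∀ f → ι (proj₁ f) ≗ F (index f)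
    value f = proj₂ (proj₂ (proj₂ f))

    -- Acting on the carried posets keeps results inside the family; `F-⊔` and `F-⊕` then identify
    -- the resulting series with the formulas.
    _∪_ _∙_ : Carrier → Carrier → Carrier
    f ∪ g = member (index f ⊔ index g) (⊔-IsSP∅ (index f) (index g) (isSP∅ f) (isSP∅ g))
    f ∙ g = member (index f ⊕ index g) (⊕-IsSP∅ (index f) (index g) (isSP∅ f) (isSP∅ g))

    -- Different posets may have the same series, so P and Q need not be
    -- the posets that f and g come with.
    ∪-value : ∀ P Q → IsSP∅ P → IsSP∅ Q → ∀ f g → ι (proj₁ f) ≗ F P → ι (proj₁ g) ≗ F Q →
              ι (proj₁ (f ∪ g)) ≗ F (P ⊔ Q)
    ∪-value P Q p q f g f≗ g≗ n = begin
      ι (proj₁ (f ∪ g)) n          ≡⟨ value (f ∪ g) n ⟩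
      F (index f ⊔ index g) n      ≡⟨ F-⊔ (index f) (index g) (isSP∅ f) (isSP∅ g) (proj₁ f) (proj₁ g) (value f) (value g) n ⟩
      op-⊔ (proj₁ f) (proj₁ g) n   ≡⟨ F-⊔ P Q p q (proj₁ f) (proj₁ g) f≗ g≗ n ⟨
      F (P ⊔ Q) n                  ∎
      where open ≡-Reasoning

    ∙-value : ∀ P Q → IsSP∅ P → IsSP∅ Q → ∀ f g → ι (proj₁ f) ≗ F P → ι (proj₁ g) ≗ F Q →
              ι (proj₁ (f ∙ g)) ≗ F (P ⊕ Q)
    ∙-value P Q p q f g f≗ g≗ n = begin
      ι (proj₁ (f ∙ g)) n          ≡⟨ value (f ∙ g) n ⟩
      F (index f ⊕ index g) n      ≡⟨ F-⊕ (index f) (index g) (isSP∅ f) (isSP∅ g) (proj₁ f) (proj₁ g) (value f) (value g) n ⟩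
      op-⊕ (proj₁ f) (proj₁ g) n   ≡⟨ F-⊕ P Q p q (proj₁ f) (proj₁ g) f≗ g≗ n ⟨
      F (P ⊕ Q) n                  ∎
      where open ≡-Reasoning

    -- On indices, evaluation is substitution of posets, so `act-cong` reduces to `substitute-≐` and
    -- the isomorphism invariance of `F`.
    index-eval : ∀ {X} (t : Expr X) (a : X → Carrier) → index (eval _∪_ _∙_ t a) ≡ substitute t (index ∘ a)
    index-eval (leaf x) a = refl
    index-eval (s ⊔ᵉ t) a = cong₂ _⊔_ (index-eval s a) (index-eval t a)
    index-eval (s ⊕ᵉ t) a = cong₂ _⊕_ (index-eval s a) (index-eval t a)

    eval-≐ : ∀ {n} (σ τ : 𝒮𝒫 n) → σ ≐ τ → (a : Fin n → Carrier) →
             ι (proj₁ (eval _∪_ _∙_ (expr σ) a)) ≗ ι (proj₁ (eval _∪_ _∙_ (expr τ) a))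
    eval-≐ σ τ σ≐τ a n = begin
      ι (proj₁ f) n   ≡⟨ value f n ⟩
      F (index f) n   ≡⟨ F-≈ₒ (index f) (index g) f≈g (isSP∅ f) n ⟩
      F (index g) n   ≡⟨ value g n ⟨
      ι (proj₁ g) n   ∎
      where
      open ≡-Reasoning
      f g : Carrier
      f = eval _∪_ _∙_ (expr σ) a
      g = eval _∪_ _∙_ (expr τ) a
      f≈g : index f ≈ₒ index g
      f≈g = subst₂ _≈ₒ_ (sym (index-eval (expr σ) a)) (sym (index-eval (expr τ) a))
        (substitute-≐ {σ = σ} {τ} σ≐τ (index ∘ a))

    -- An element with the unit series is not assumed to carry the empty poset; having the series of
    -- `∅` is enough for `∪-value` and `∙-value`.
    unit-value : ∀ (e : Carrier) → ι (proj₁ e) ≗ unit → ι (proj₁ e) ≗ F ∅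
    unit-value e e≗ n = trans (e≗ n) (sym (unit-∅ n))

    same-value : ∀ f Q h → ι h ≗ F Q → IsSP∅ Q → Q ≈ₒ index f → ι h ≗ ι (proj₁ f)
    same-value f Q h h≗ q θ n = trans (h≗ n) (trans (F-≈ₒ Q (index f) θ q n) (sym (value f n)))

  familyAlgebra : FamilyAlgebra ι F gen unit op-⊔ op-⊕
  familyAlgebra = record
    { contains  = contains
    ; algebra   = record
      { act-⊔    = _∪_
      ; act-⊕    = _∙_
      ; cong-⊔   = λ {f} {f′} {g} {g′} f≈ g≈ n → trans
          (∪-value (index f′) (index g′) (isSP∅ f′) (isSP∅ g′) f g
            (λ m → trans (f≈ m) (value f′ m)) (λ m → trans (g≈ m) (value g′ m)) n)
          (sym (value (f′ ∪ g′) n))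
      ; cong-⊕   = λ {f} {f′} {g} {g′} f≈ g≈ n → trans
          (∙-value (index f′) (index g′) (isSP∅ f′) (isSP∅ g′) f g
            (λ m → trans (f≈ m) (value f′ m)) (λ m → trans (g≈ m) (value g′ m)) n)
          (sym (value (f′ ∙ g′) n))
      ; act-cong = λ {n} {σ} {τ} → eval-≐ σ τ }
    ; ⊔-formula = λ f g n → trans (value (f ∪ g) n)
        (F-⊔ (index f) (index g) (isSP∅ f) (isSP∅ g) (proj₁ f) (proj₁ g) (value f) (value g) n)
    ; ⊕-formula = λ f g n → trans (value (f ∙ g) n)
        (F-⊕ (index f) (index g) (isSP∅ f) (isSP∅ g) (proj₁ f) (proj₁ g) (value f) (value g) n)
    ; ⊔-series  = λ {P} {Q} p q → ∪-value P Q (inj₁ p) (inj₁ q)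
    ; ⊕-series  = λ {P} {Q} p q → ∙-value P Q (inj₁ p) (inj₁ q)
    ; generator = generator
    ; unit-∅    = unit-∅
    ; ⊔-unit    = λ e e≗ →
        (λ f → same-value f (∅ ⊔ index f) (proj₁ (e ∪ f))
          (∪-value ∅ (index f) ∅-IsSP∅ (isSP∅ f) e f (unit-value e e≗) (value f))
          (⊔-IsSP∅ ∅ (index f) ∅-IsSP∅ (isSP∅ f)) (⊔-emptyˡ ∅ ≃-refl (index f))) ,
        (λ f → same-value f (index f ⊔ ∅) (proj₁ (f ∪ e))
          (∪-value (index f) ∅ (isSP∅ f) ∅-IsSP∅ f e (value f) (unit-value e e≗))
          (⊔-IsSP∅ (index f) ∅ (isSP∅ f) ∅-IsSP∅) (⊔-emptyʳ ∅ ≃-refl (index f)))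
    ; ⊕-unit    = λ e e≗ →
        (λ f → same-value f (∅ ⊕ index f) (proj₁ (e ∙ f))
          (∙-value ∅ (index f) ∅-IsSP∅ (isSP∅ f) e f (unit-value e e≗) (value f))
          (⊕-IsSP∅ ∅ (index f) ∅-IsSP∅ (isSP∅ f)) (⊕-emptyˡ ∅ ≃-refl (index f))) ,
        (λ f → same-value f (index f ⊕ ∅) (proj₁ (f ∙ e))
          (∙-value (index f) ∅ (isSP∅ f) ∅-IsSP∅ f e (value f) (unit-value e e≗))
          (⊕-IsSP∅ (index f) ∅ (isSP∅ f) ∅-IsSP∅) (⊕-emptyʳ ∅ ≃-refl (index f))) }

-- The three families of shuffle series

module _ (d : FinPoset → ℕ → ℤ) (correct : IsStrictCoefficients d) where

  open Expansion d correct

  signed-⊕-formula : ∀ {b} → Geometric b → ∀ P Q → IsSP∅ P → IsSP∅ Q → ∀ f g →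
                     f ≗ signed b P → g ≗ signed b Q → signed b (P ⊕ Q) ≗ f · 1-x · g
  signed-⊕-formula {b} G P Q p q f g f≗ g≗ n = trans (signed-⊕ G P Q p q n)
    (sym (·-cong {f · 1-x} {signed b P · 1-x} {g} {signed b Q} (·-congʳ 1-x f≗) g≗ n))

  SH-algebra : FamilyAlgebra id (SH d) (1/[1-x] ^ 2) 1/[1-x] (λ f g → f ⊙ g) (λ f g → f · 1-x · g)
  SH-algebra = familyAlgebra id (SH d) (λ f g → f ⊙ g) (λ f g → f · 1-x · g)
    (λ P _ → SH d P , λ _ → refl)
    (signed-≈ₒ 1/[1-x]^1+)
    (λ P Q p q f g f≗ g≗ n → trans (signed-⊔ P Q p q n) (sym (cong₂ _*_ (f≗ n) (g≗ n))))
    (signed-⊕-formula 1/[1-x]^1+-geometric)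
    (signed-pt 1/[1-x]^1+)
    (λ n → trans (signed-∅ 1/[1-x]^1+ n) (1/[1-x]^1+-0 n))

  -- The stored list of `f` may differ from the signed coefficients of P, but independence of
  -- `[1-x]^-1+` shows that `ψ⁻¹ f` has the series `SH d P`. The Hadamard formula for `SH` then
  -- applies, and independence of `1/[1-x]^1+` carries it back.
  ddSH-⊔-formula : ∀ P Q → IsSP∅ P → IsSP∅ Q → ∀ f g → series f ≗ ddSH d P → series g ≗ ddSH d Q →
                   ddSH d (P ⊔ Q) ≗ series (ψ (ψ⁻¹ f ⊙ˢ ψ⁻¹ g))
  ddSH-⊔-formula P Q p q f g f≗ g≗ n = trans (signed-combination [1-x]^-1+ (P ⊔ Q) n)
    (change-of-basis 1/[1-x]^1+-independent (signed-coefficients (P ⊔ Q)) (mul (coeffs f) (coeffs g)) eq [1-x]^-1+ n)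
    where
    open ≡-Reasoning
    SH-coeffs : ∀ P f → series f ≗ ddSH d P → SH d P ≗ combination 1/[1-x]^1+ (coeffs f)
    SH-coeffs P f f≗ n = trans (signed-combination 1/[1-x]^1+ P n)
      (change-of-basis [1-x]^-1+-independent (signed-coefficients P) (coeffs f)
        (λ n → trans (sym (signed-combination [1-x]^-1+ P n)) (trans (sym (f≗ n)) (expansion f n))) 1/[1-x]^1+ n)
    eq : combination 1/[1-x]^1+ (signed-coefficients (P ⊔ Q)) ≗ combination 1/[1-x]^1+ (mul (coeffs f) (coeffs g))
    eq n = begin
      combination 1/[1-x]^1+ (signed-coefficients (P ⊔ Q)) n  ≡⟨ signed-combination 1/[1-x]^1+ (P ⊔ Q) n ⟨
      SH d (P ⊔ Q) n                                          ≡⟨ signed-⊔ P Q p q n ⟩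
      SH d P n * SH d Q n                                     ≡⟨ cong₂ _*_ (SH-coeffs P f f≗ n) (SH-coeffs Q g g≗ n) ⟩
      combination 1/[1-x]^1+ (coeffs f) n * combination 1/[1-x]^1+ (coeffs g) n
                                                              ≡⟨ mul-correct (coeffs f) (coeffs g) n ⟨
      combination 1/[1-x]^1+ (mul (coeffs f) (coeffs g)) n    ∎

  ddSH-algebra : FamilyAlgebra {Span [1-x]^-1+} series (ddSH d) 𝟏 1/[1-x]
    (λ f g → series (ψ (ψ⁻¹ f ⊙ˢ ψ⁻¹ g))) (λ f g → series f · 1-x · series g)
  ddSH-algebra = familyAlgebra series (ddSH d) (λ f g → series (ψ (ψ⁻¹ f ⊙ˢ ψ⁻¹ g))) (λ f g → series f · 1-x · series g)
    (λ P _ → span (ddSH d P) (signed-coefficients P) (signed-combination [1-x]^-1+ P) , λ _ → refl)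
    (signed-≈ₒ [1-x]^-1+)
    ddSH-⊔-formula
    (λ P Q p q f g → signed-⊕-formula [1-x]^-1+-geometric P Q p q (series f) (series g))
    (signed-pt [1-x]^-1+)
    (signed-∅ [1-x]^-1+)

  lddSH-suc : ∀ P → IsSP∅ P → ∀ n → lddSH d P (suc n) ≡ Ω°-series P n
  lddSH-suc P p n = trans (lddSH-Ω° P p (suc n)) (𝐱·-suc (Ω°-series P) n)

  lddSH-⊔-formula : ∀ P Q → IsSP∅ P → IsSP∅ Q → ∀ (f g : xℤ[[x]]) → proj₁ f ≗ lddSH d P → proj₁ g ≗ lddSH d Q →
                    lddSH d (P ⊔ Q) ≗ proj₁ f ⊙ proj₁ g
  lddSH-⊔-formula P Q p q f g f≗ g≗ zero = trans (lddSH-Ω° (P ⊔ Q) (⊔-IsSP∅ P Q p q) 0)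
    (sym (cong (_* proj₁ g 0) (proj₂ f)))
  lddSH-⊔-formula P Q p q f g f≗ g≗ (suc n) = trans (lddSH-suc (P ⊔ Q) (⊔-IsSP∅ P Q p q) n)
    (trans (Ω°-⊔ P Q n) (sym (cong₂ _*_ (trans (f≗ (suc n)) (lddSH-suc P p n)) (trans (g≗ (suc n)) (lddSH-suc Q q n)))))

  -- Both arguments carry a factor x and the result only one; dividing `f` by x removes the surplus
  -- and leaves the formula for Ω°.
  lddSH-⊕-formula : ∀ P Q → IsSP∅ P → IsSP∅ Q → ∀ (f g : xℤ[[x]]) → proj₁ f ≗ lddSH d P → proj₁ g ≗ lddSH d Q →
                    lddSH d (P ⊕ Q) ≗ (proj₁ f /x) · 1-x · proj₁ g
  lddSH-⊕-formula P Q p q f g f≗ g≗ n = begin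
    lddSH d (P ⊕ Q) n
      ≡⟨ lddSH-Ω° (P ⊕ Q) (⊕-IsSP∅ P Q p q) n ⟩
    (𝐱 · Ω°-series (P ⊕ Q)) n
      ≡⟨ ·-congˡ 𝐱 (Ω°-⊕-IsSP∅ P Q p) n ⟩
    (𝐱 · (Ω°-series P · 1-x · Ω°-series Q)) n
      ≡⟨ solve 4 (λ x a u b → x ⊗ ((a ⊗ u) ⊗ b) ⊜ (a ⊗ u) ⊗ (x ⊗ b)) (λ _ → refl) 𝐱 (Ω°-series P) 1-x (Ω°-series Q) n ⟩
    (Ω°-series P · 1-x · (𝐱 · Ω°-series Q)) n
      ≡⟨ ·-cong {(proj₁ f /x) · 1-x} {Ω°-series P · 1-x} {proj₁ g} {𝐱 · Ω°-series Q}
           (·-congʳ 1-x (λ m → trans (f≗ (suc m)) (lddSH-suc P p m)))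
           (λ m → trans (g≗ m) (lddSH-Ω° Q q m)) n ⟨
    ((proj₁ f /x) · 1-x · proj₁ g) n ∎
    where open ≡-Reasoning

  lddSH-algebra : FamilyAlgebra {xℤ[[x]]} proj₁ (lddSH d) (𝐱 ^ 2 · 1/[1-x] ^ 2) (𝐱 · 1/[1-x])
    (λ f g → proj₁ f ⊙ proj₁ g) (λ f g → (proj₁ f /x) · 1-x · proj₁ g)
  lddSH-algebra = familyAlgebra proj₁ (lddSH d) (λ f g → proj₁ f ⊙ proj₁ g) (λ f g → (proj₁ f /x) · 1-x · proj₁ g)
    (λ P p → (lddSH d P , lddSH-Ω° P p 0) , λ _ → refl)
    (λ P Q θ p n → trans (lddSH-Ω° P p n) (trans (·-congˡ 𝐱 (Ω°-≈ₒ P Q θ) n)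
      (sym (lddSH-Ω° Q (IsSP∅-resp P Q θ p) n))))
    lddSH-⊔-formula
    lddSH-⊕-formula
    (λ n → trans (lddSH-Ω° pt pt-IsSP∅ n) (trans
      (·-congˡ 𝐱 (λ m → trans (Ω°-pt m) (cong +_ (sym (nC1≡n m)))) n)
      (sym (lddSH-basis 1 n))))
    (λ n → trans (lddSH-Ω° ∅ ∅-IsSP∅ n) (·-congˡ 𝐱 (Ω°-∅ ∅ ≃-refl) n))

lemma3p15 : (Σ[ d ∈ (FinPoset → ℕ → ℤ) ] IsStrictCoefficients d) ×
    ((f g : Span 1/[1-x]^1+) → (series f ≗ series g) ⇔ (series (ψ f) ≗ series (ψ g))) ×
    ((d : FinPoset → ℕ → ℤ) → IsStrictCoefficients d →
    FamilyAlgebra {Series} id (SH d)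
    (1/[1-x] ^ 2)
    1/[1-x]
    (λ f g → f ⊙ g)
    (λ f g → f · 1-x · g)
    ×
    FamilyAlgebra {Span [1-x]^-1+} series (ddSH d)
    𝟏
    1/[1-x]
    (λ f g → series (ψ (ψ⁻¹ f ⊙ˢ ψ⁻¹ g)))
    (λ f g → series f · 1-x · series g)
    ×
    FamilyAlgebra {xℤ[[x]]} proj₁ (lddSH d)
    (𝐱 ^ 2 · 1/[1-x] ^ 2)
    (𝐱 · 1/[1-x])
    (λ f g → proj₁ f ⊙ proj₁ g)
    (λ f g → (proj₁ f /x) · 1-x · proj₁ g))
lemma3p15 = (strict-coefficients , strict-coefficients-correct) , ψ-injective ,
  λ d correct → SH-algebra d correct , ddSH-algebra d correct , lddSH-algebra d correct
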